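{- Let $n\geq 1$. For every real $r\geq 2$, the Vietoris--Rips complex $\mathrm{VR}(\mathbb{Z}^n;r)$ is simply connected.
   Context: $\mathbb{Z}^n$ is equipped with the Manhattan metric $d(x,y)=\sum_{i=1}^n |x_i-y_i|$. For a metric space $X$ and $r\geq 0$, $\mathrm{VR}(X;r)$ is the simplicial complex with vertex set $X$ whose simplices are the finite subsets of $X$ of diameter at most $r$. -}

module Defs where

open import Algebra.Bundles using (CommutativeRing)
open import Data.Empty using (⊥-elim)
open import Data.Integer.Base as ℤ using (ℤ)
open import Data.Integer.Properties as ℤ using ()
open import Data.List.Base as List using (List; []; _∷_)
open import Data.List.Membership.Propositional using (_∈_; _∉_)
open import Data.List.Relation.Binary.Subset.Propositional using (_⊆_)
open import Data.List.Relation.Unary.Any using (here)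
open import Data.List.Relation.Unary.Unique.Propositional using (Unique)
open import Data.Nat.Base as ℕ using (ℕ; zero; suc)
open import Data.Nat.Properties as ℕ using ()
open import Data.Product using (Σ; ∃-syntax; _×_; _,_; proj₁; proj₂)
open import Data.Sum.Base using (inj₁; inj₂)
open import Data.Unit.Base using (tt)
open import Data.Vec.Base as Vec using (Vec; []; _∷_)
open import Function.Base using (_∘_)
open import Function.Metric.Structures using (IsGeneralMetric)
open import Level using (Level; 0ℓ; _⊔_) renaming (suc to lsuc)
open import Relation.Binary.Core using (Rel; _Preserves_⟶_)
open import Relation.Binary.Definitions using (_Respects_)
open import Relation.Binary.PropositionalEquality as ≡ using (_≡_; _≢_)
open import Relation.Binary.Structures using (IsEquivalence; IsTotalOrder)
open import Relation.Nullary.Negation using (¬_)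
open import Relation.Unary using (Pred; Satisfiable; _≐_; _∩_; ⋃; U)

import Algebra.Properties.Monoid.Mult as Mult
import Algebra.Properties.Ring as RingProperties
import Relation.Binary.Construct.NonStrictToStrict as ToStrict

-- The real numbers, characterised up to isomorphism as the
-- Dedekind-complete ordered field.
record CompleteOrderedField : Set₁ where
  infix 4 _≤_
  field
    commutativeRing : CommutativeRing 0ℓ 0ℓ

  open CommutativeRing commutativeRing public

  field
    _≤_          : Rel Carrier 0ℓ
    isTotalOrder : IsTotalOrder _≈_ _≤_
    0≉1          : ¬ (0# ≈ 1#)
    inverse      : ∀ x → ¬ (x ≈ 0#) → ∃[ y ] x * y ≈ 1#
    +-monoˡ-≤    : ∀ z {x y} → x ≤ y → x + z ≤ y + z
    *-nonNeg     : ∀ {x y} → 0# ≤ x → 0# ≤ y → 0# ≤ x * y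

  UpperBound : Pred Carrier 0ℓ → Pred Carrier 0ℓ
  UpperBound P u = ∀ x → P x → x ≤ u

  field
    supremum : ∀ (P : Pred Carrier 0ℓ) → Satisfiable P → Satisfiable (UpperBound P) →
               ∃[ s ] UpperBound P s × (∀ u → UpperBound P u → s ≤ u)

  module ≤ = IsTotalOrder isTotalOrder

  open ToStrict _≈_ _≤_ public using (_<_)

  2# : Carrier
  2# = 1# + 1#

  fromℕ : ℕ → Carrier
  fromℕ n = Mult._×_ +-monoid n 1#

  -- ∣ x - y ∣ < ε
  Near : Carrier → Rel Carrier 0ℓ
  Near ε x y = x < y + ε × y < x + ε

module OrderLemmas (ℝ : CompleteOrderedField) where
  open CompleteOrderedField ℝ
  open RingProperties ring using (-1*x≈-x; -‿involutive)

  <-≤-trans : ∀ {x y z} → x < y → y ≤ z → x < z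
  <-≤-trans = ToStrict.<-≤-trans _≈_ _≤_ sym ≤.trans ≤.antisym ≤.≤-respʳ-≈

  ≤-respˡ : ∀ {x y z} → x ≈ y → x ≤ z → y ≤ z
  ≤-respˡ = ≤.≤-respˡ-≈

  ≤-respʳ : ∀ {x y z} → x ≈ y → z ≤ x → z ≤ y
  ≤-respʳ = ≤.≤-respʳ-≈

  +-monoʳ-≤ : ∀ z {x y} → x ≤ y → z + x ≤ z + y
  +-monoʳ-≤ z {x} {y} p =
    ≤-respˡ (+-comm x z) (≤-respʳ (+-comm y z) (+-monoˡ-≤ z p))

  0≤1 : 0# ≤ 1#
  0≤1 with ≤.total 0# 1#
  ... | inj₁ p = p
  ... | inj₂ p = ≤-respʳ -1*-1≈1 (*-nonNeg 0≤-1 0≤-1)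
    where
    0≤-1 : 0# ≤ - 1#
    0≤-1 = ≤-respˡ (-‿inverseʳ 1#) (≤-respʳ (+-identityˡ (- 1#)) (+-monoˡ-≤ (- 1#) p))
    -1*-1≈1 : - 1# * - 1# ≈ 1#
    -1*-1≈1 = trans (-1*x≈-x (- 1#)) (-‿involutive 1#)

  0≤2 : 0# ≤ 2#
  0≤2 = ≤.trans 0≤1 (≤-respˡ (+-identityˡ 1#) (+-monoˡ-≤ 1# 0≤1))

  0<1 : 0# < 1#
  0<1 = 0≤1 , 0≉1

  x<x+ε : ∀ x {ε} → 0# < ε → x < x + ε
  x<x+ε x {ε} (0≤ε , 0≉ε) =
    ≤-respˡ (+-identityʳ x) (+-monoʳ-≤ x 0≤ε) , λ x≈x+ε → 0≉ε (cancel x≈x+ε)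
    where
    cancel : x ≈ x + ε → 0# ≈ ε
    cancel eq = trans (sym (-‿inverseˡ x))
      (trans (+-congˡ eq) (trans (sym (+-assoc (- x) x ε))
      (trans (+-congʳ (-‿inverseˡ x)) (+-identityˡ ε))))

  Near-mono : ∀ {ε δ x y} → ε ≤ δ → Near ε x y → Near δ x y
  Near-mono {x = x} {y} ε≤δ (p , q) =
    <-≤-trans p (+-monoʳ-≤ y ε≤δ) , <-≤-trans q (+-monoʳ-≤ x ε≤δ)

  ≈⇒Near : ∀ {ε x y} → 0# < ε → x ≈ y → Near ε x y
  ≈⇒Near {ε} {x} {y} 0<ε x≈y = close x≈y , close (sym x≈y)
    where
    close : ∀ {u v} → u ≈ v → u < v + ε
    close {u} {v} u≈v = let p , q = x<x+ε v 0<ε in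
      ≤-respˡ (sym u≈v) p , λ e → q (trans (sym u≈v) e)

  minimum : ∀ {ε δ} → 0# < ε → 0# < δ → ∃[ η ] 0# < η × η ≤ ε × η ≤ δ
  minimum {ε} {δ} p q with ≤.total ε δ
  ... | inj₁ ε≤δ = ε , p , ≤.refl , ε≤δ
  ... | inj₂ δ≤ε = δ , q , δ≤ε , ≤.refl

  fromℕ-+ : ∀ m n → fromℕ (m ℕ.+ n) ≈ fromℕ m + fromℕ n
  fromℕ-+ = Mult.×-homo-+ +-monoid 1#

  0≤fromℕ : ∀ n → 0# ≤ fromℕ n
  0≤fromℕ zero    = ≤.refl
  0≤fromℕ (suc n) = ≤.trans (0≤fromℕ n)
    (≤-respˡ (+-identityˡ (fromℕ n)) (+-monoˡ-≤ (fromℕ n) 0≤1))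

  fromℕ-mono : ∀ {m n} → m ℕ.≤ n → fromℕ m ≤ fromℕ n
  fromℕ-mono {n = n} ℕ.z≤n = 0≤fromℕ n
  fromℕ-mono (ℕ.s≤s p)     = +-monoʳ-≤ 1# (fromℕ-mono p)

  fromℕ≈0⇒≡0 : ∀ n → fromℕ n ≈ 0# → n ≡ 0
  fromℕ≈0⇒≡0 zero    _  = ≡.refl
  fromℕ≈0⇒≡0 (suc n) eq = ⊥-elim (0≉1 (≤.antisym 0≤1
    (≤-respʳ eq (≤-respˡ (+-identityʳ 1#) (+-monoʳ-≤ 1# (0≤fromℕ n))))))

-- Topological spaces.  Points are compared by an equivalence _≈_ and open
-- sets are saturated, so this is the topology of the quotient by _≈_.
record Space (o : Level) : Set (lsuc 0ℓ ⊔ lsuc o) where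
  infix 4 _≈_
  field
    Carrier       : Set
    _≈_           : Rel Carrier 0ℓ
    isEquivalence : IsEquivalence _≈_
    IsOpen        : Pred Carrier 0ℓ → Set o
    open-resp     : ∀ {P} → IsOpen P → P Respects _≈_
    open-≐        : ∀ {P Q} → P ≐ Q → IsOpen P → IsOpen Q
    open-U        : IsOpen U
    open-∩        : ∀ {P Q} → IsOpen P → IsOpen Q → IsOpen (P ∩ Q)
    open-⋃        : ∀ (I : Set) {P : I → Pred Carrier 0ℓ} →
                    (∀ i → IsOpen (P i)) → IsOpen (⋃ I P)

  module Eq = IsEquivalence isEquivalence

record ContinuousMap {o p} (X : Space o) (Y : Space p) : Set (lsuc 0ℓ ⊔ o ⊔ p) where
  private
    module X = Space X
    module Y = Space Y
  field
    _⟨$⟩_      : X.Carrier → Y.Carrier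
    cong       : _⟨$⟩_ Preserves X._≈_ ⟶ Y._≈_
    continuous : ∀ P → Y.IsOpen P → X.IsOpen (P ∘ _⟨$⟩_)

open ContinuousMap public using (_⟨$⟩_)

infixr 2 _×ₛ_

_×ₛ_ : ∀ {o p} → Space o → Space p → Space (lsuc 0ℓ ⊔ o ⊔ p)
X ×ₛ Y = record
  { Carrier       = X.Carrier × Y.Carrier
  ; _≈_           = λ (x , y) (x′ , y′) → (x X.≈ x′) × (y Y.≈ y′)
  ; isEquivalence = record
      { refl  = X.Eq.refl , Y.Eq.refl
      ; sym   = λ (p , q) → X.Eq.sym p , Y.Eq.sym q
      ; trans = λ (p , q) (p′ , q′) → X.Eq.trans p p′ , Y.Eq.trans q q′
      }
  ; IsOpen        = λ P → ∀ x y → P (x , y) →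
                    Σ (Pred X.Carrier 0ℓ) λ V → Σ (Pred Y.Carrier 0ℓ) λ W →
                    X.IsOpen V × Y.IsOpen W × V x × W y ×
                    (∀ x′ y′ → V x′ → W y′ → P (x′ , y′))
  ; open-resp     = λ {P} oP {(x , y)} {(x′ , y′)} (x≈ , y≈) Pxy →
      let V , W , oV , oW , Vx , Wy , sub = oP x y Pxy
      in sub x′ y′ (X.open-resp oV x≈ Vx) (Y.open-resp oW y≈ Wy)
  ; open-≐        = λ (P⊆Q , Q⊆P) oP x y Qxy →
      let V , W , oV , oW , Vx , Wy , sub = oP x y (Q⊆P Qxy)
      in V , W , oV , oW , Vx , Wy , λ x′ y′ v w → P⊆Q (sub x′ y′ v w)
  ; open-U        = λ _ _ _ → U , U , X.open-U , Y.open-U , tt , tt , λ _ _ _ _ → tt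
  ; open-∩        = λ oP oQ x y (Pxy , Qxy) →
      let V  , W  , oV  , oW  , Vx  , Wy  , sub  = oP x y Pxy
          V′ , W′ , oV′ , oW′ , Vx′ , Wy′ , sub′ = oQ x y Qxy
      in V ∩ V′ , W ∩ W′ , X.open-∩ oV oV′ , Y.open-∩ oW oW′ , (Vx , Vx′) , (Wy , Wy′) ,
         λ x′ y′ (v , v′) (w , w′) → sub x′ y′ v w , sub′ x′ y′ v′ w′
  ; open-⋃        = λ I oP x y (i , Pxy) →
      let V , W , oV , oW , Vx , Wy , sub = oP i x y Pxy
      in V , W , oV , oW , Vx , Wy , λ x′ y′ v w → i , sub x′ y′ v w
  }
  where
  module X = Space X
  module Y = Space Y

constant : ∀ {o p} (X : Space o) (Y : Space p) → Space.Carrier Y → ContinuousMap X Y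
constant X Y y = record
  { _⟨$⟩_      = λ _ → y
  ; cong       = λ _ → Space.Eq.refl Y
  ; continuous = λ P _ → X.open-≐ ((λ (p , _) → p) , (λ p → p , tt))
                                  (X.open-⋃ (P y) (λ _ → X.open-U))
  }
  where
  module X = Space X

-- Finite sets of vertices are represented by lists; `face` makes IsSimplex
-- independent of the order and multiplicity of the entries.
record SimplicialComplex : Set₁ where
  field
    Vertex    : Set
    IsSimplex : Pred (List Vertex) 0ℓ
    nonEmpty  : ∀ {σ} → IsSimplex σ → σ ≢ []
    vertex    : ∀ v → IsSimplex List.[ v ]
    face      : ∀ {σ τ} → IsSimplex σ → τ ⊆ σ → τ ≢ [] → IsSimplex τ

manhattan : ∀ {n} → Vec ℤ n → Vec ℤ n → ℕ
manhattan x y = Vec.sum (Vec.zipWith (λ a b → ℤ.∣ a ℤ.- b ∣) x y)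

private
  manhattan-refl : ∀ {n} (x : Vec ℤ n) → manhattan x x ≡ 0
  manhattan-refl []      = ≡.refl
  manhattan-refl (a ∷ x) =
    ≡.cong₂ ℕ._+_ (≡.cong ℤ.∣_∣ (ℤ.+-inverseʳ a)) (manhattan-refl x)

  manhattan-≡ : ∀ {n} (x : Vec ℤ n) {y} → x ≡ y → manhattan x y ≡ 0
  manhattan-≡ x ≡.refl = manhattan-refl x

  manhattan-zero : ∀ {n} (x y : Vec ℤ n) → manhattan x y ≡ 0 → x ≡ y
  manhattan-zero []      []      _  = ≡.refl
  manhattan-zero (a ∷ x) (b ∷ y) eq = ≡.cong₂ _∷_
    (ℤ.i-j≡0⇒i≡j a b (ℤ.∣i∣≡0⇒i≡0 (ℕ.m+n≡0⇒m≡0 ℤ.∣ a ℤ.- b ∣ eq)))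
    (manhattan-zero x y (ℕ.m+n≡0⇒n≡0 ℤ.∣ a ℤ.- b ∣ eq))

  manhattan-sym : ∀ {n} (x y : Vec ℤ n) → manhattan x y ≡ manhattan y x
  manhattan-sym []      []      = ≡.refl
  manhattan-sym (a ∷ x) (b ∷ y) =
    ≡.cong₂ ℕ._+_ (ℤ.∣i-j∣≡∣j-i∣ a b) (manhattan-sym x y)

  ∣-∣-triangle : ∀ a b c → ℤ.∣ a ℤ.- c ∣ ℕ.≤ ℤ.∣ a ℤ.- b ∣ ℕ.+ ℤ.∣ b ℤ.- c ∣
  ∣-∣-triangle a b c = ≡.subst (λ z → ℤ.∣ z ∣ ℕ.≤ ℤ.∣ a ℤ.- b ∣ ℕ.+ ℤ.∣ b ℤ.- c ∣)
    telescope (ℤ.∣i+j∣≤∣i∣+∣j∣ (a ℤ.- b) (b ℤ.- c))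
    where
    open ≡.≡-Reasoning
    telescope : (a ℤ.- b) ℤ.+ (b ℤ.- c) ≡ a ℤ.- c
    telescope = begin
      (a ℤ.- b) ℤ.+ (b ℤ.- c)         ≡⟨ ℤ.+-assoc a (ℤ.- b) (b ℤ.- c) ⟩
      a ℤ.+ (ℤ.- b ℤ.+ (b ℤ.- c))     ≡⟨ ≡.cong (λ z → a ℤ.+ z) (ℤ.+-assoc (ℤ.- b) b (ℤ.- c)) ⟨
      a ℤ.+ ((ℤ.- b ℤ.+ b) ℤ.- c)     ≡⟨ ≡.cong (λ z → a ℤ.+ (z ℤ.- c)) (ℤ.+-inverseˡ b) ⟩
      a ℤ.+ (ℤ.0ℤ ℤ.- c)              ≡⟨ ≡.cong (λ z → a ℤ.+ z) (ℤ.+-identityˡ (ℤ.- c)) ⟩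
      a ℤ.- c                         ∎

  manhattan-triangle : ∀ {n} (x y z : Vec ℤ n) →
                       manhattan x z ℕ.≤ manhattan x y ℕ.+ manhattan y z
  manhattan-triangle []      []      []      = ℕ.z≤n
  manhattan-triangle (a ∷ x) (b ∷ y) (c ∷ z) = begin
    ac ℕ.+ manhattan x z                                  ≤⟨ ℕ.+-mono-≤ (∣-∣-triangle a b c) (manhattan-triangle x y z) ⟩
    (ab ℕ.+ bc) ℕ.+ (manhattan x y ℕ.+ manhattan y z)     ≡⟨ interchange ab bc (manhattan x y) (manhattan y z) ⟩
    (ab ℕ.+ manhattan x y) ℕ.+ (bc ℕ.+ manhattan y z)     ∎
    where
    open ℕ.≤-Reasoning
    open import Algebra.Properties.CommutativeSemigroup ℕ.+-commutativeSemigroup using (interchange)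
    ab bc ac : ℕ
    ab = ℤ.∣ a ℤ.- b ∣
    bc = ℤ.∣ b ℤ.- c ∣
    ac = ℤ.∣ a ℤ.- c ∣

module _ (ℝ : CompleteOrderedField) where
  open CompleteOrderedField ℝ
  open OrderLemmas ℝ

  record UnitIntervalPoint : Set where
    constructor mkPoint
    field
      value   : Carrier
      0≤value : 0# ≤ value
      value≤1 : value ≤ 1#

  open UnitIntervalPoint public

  UnitInterval : Space 0ℓ
  UnitInterval = record
    { Carrier       = UnitIntervalPoint
    ; _≈_           = λ s t → value s ≈ value t
    ; isEquivalence = record { refl = refl ; sym = sym ; trans = trans }
    ; IsOpen        = λ P → ∀ t → P t →
                      ∃[ ε ] 0# < ε × (∀ s → Near ε (value t) (value s) → P s)
    ; open-resp     = λ {P} oP {t} {s} t≈s Pt →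
        let ε , 0<ε , ball = oP t Pt in ball s (≈⇒Near 0<ε t≈s)
    ; open-≐        = λ (P⊆Q , Q⊆P) oP t Qt →
        let ε , 0<ε , ball = oP t (Q⊆P Qt) in ε , 0<ε , λ s near → P⊆Q (ball s near)
    ; open-U        = λ _ _ → 1# , 0<1 , λ _ _ → tt
    ; open-∩        = λ oP oQ t (Pt , Qt) →
        let ε , 0<ε , ball  = oP t Pt
            δ , 0<δ , ball′ = oQ t Qt
            η , 0<η , η≤ε , η≤δ = minimum 0<ε 0<δ
        in η , 0<η , λ s near → ball s (Near-mono η≤ε near) , ball′ s (Near-mono η≤δ near)
    ; open-⋃        = λ I oP t (i , Pt) →
        let ε , 0<ε , ball = oP i t Pt in ε , 0<ε , λ s near → i , ball s near
    }

  0ᴵ 1ᴵ : UnitIntervalPoint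
  0ᴵ = mkPoint 0# ≤.refl 0≤1
  1ᴵ = mkPoint 1# 0≤1 ≤.refl

  module _ {o} (X : Space o) where
    private
      module X = Space X

    record Path (x y : X.Carrier) : Set (lsuc 0ℓ ⊔ o) where
      field
        map    : ContinuousMap UnitInterval X
        source : (map ⟨$⟩ 0ᴵ) X.≈ x
        target : (map ⟨$⟩ 1ᴵ) X.≈ y

    constantPath : ∀ x → Path x x
    constantPath x = record
      { map = constant UnitInterval X x ; source = X.Eq.refl ; target = X.Eq.refl }

    -- Homotopy relative to the endpoints; the first coordinate is the
    -- deformation parameter.
    record PathHomotopy {x y : X.Carrier} (γ δ : Path x y) : Set (lsuc 0ℓ ⊔ o) where
      field
        map    : ContinuousMap (UnitInterval ×ₛ UnitInterval) X
        bottom : ∀ t → (map ⟨$⟩ (0ᴵ , t)) X.≈ (Path.map γ ⟨$⟩ t)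
        top    : ∀ t → (map ⟨$⟩ (1ᴵ , t)) X.≈ (Path.map δ ⟨$⟩ t)
        source : ∀ s → (map ⟨$⟩ (s , 0ᴵ)) X.≈ x
        target : ∀ s → (map ⟨$⟩ (s , 1ᴵ)) X.≈ y

    record SimplyConnected : Set (lsuc 0ℓ ⊔ o) where
      field
        inhabited     : X.Carrier
        pathConnected : ∀ x y → Path x y
        trivialLoops  : ∀ x (γ : Path x x) → PathHomotopy γ (constantPath x)

  module _ (K : SimplicialComplex) where
    open SimplicialComplex K

    -- Points of the geometric realization, in barycentric coordinates.
    -- Uniqueness of the entries of `carrier` makes the sum in `sum≈1`
    -- a sum over the underlying set.
    record RealizationPoint : Set where
      field
        coord     : Vertex → Carrier
        carrier   : List Vertex
        isSimplex : IsSimplex carrier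
        unique    : Unique carrier
        supported : ∀ v → v ∉ carrier → coord v ≈ 0#
        0≤coord   : ∀ v → 0# ≤ coord v
        sum≈1     : List.foldr _+_ 0# (List.map coord carrier) ≈ 1#

    open RealizationPoint

    InClosedSimplex : List Vertex → Pred RealizationPoint 0ℓ
    InClosedSimplex σ x = ∀ v → v ∉ σ → coord x v ≈ 0#

    -- The weak topology: a set is open when its intersection with each
    -- closed simplex ∣σ∣ is open in the Euclidean topology of ∣σ∣ ⊆ ℝ^σ.
    Realization : Space 0ℓ
    Realization = record
      { Carrier       = RealizationPoint
      ; _≈_           = λ x y → ∀ v → coord x v ≈ coord y v
      ; isEquivalence = record
          { refl  = λ _ → refl
          ; sym   = λ p v → sym (p v)
          ; trans = λ p q v → trans (p v) (q v)
          }
      ; IsOpen        = λ P → ∀ σ → IsSimplex σ → ∀ x → InClosedSimplex σ x → P x →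
                        ∃[ ε ] 0# < ε × (∀ y → InClosedSimplex σ y →
                          (∀ v → v ∈ σ → Near ε (coord x v) (coord y v)) → P y)
      ; open-resp     = λ {P} oP {x} {y} x≈y Px →
          let ε , 0<ε , ball = oP (carrier x) (isSimplex x) x (supported x) Px
          in ball y (λ v v∉ → trans (sym (x≈y v)) (supported x v v∉))
                    (λ v _ → ≈⇒Near 0<ε (x≈y v))
      ; open-≐        = λ (P⊆Q , Q⊆P) oP σ σ∈K x x∈σ Qx →
          let ε , 0<ε , ball = oP σ σ∈K x x∈σ (Q⊆P Qx)
          in ε , 0<ε , λ y y∈σ near → P⊆Q (ball y y∈σ near)
      ; open-U        = λ _ _ _ _ _ → 1# , 0<1 , λ _ _ _ → tt
      ; open-∩        = λ oP oQ σ σ∈K x x∈σ (Px , Qx) →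
          let ε , 0<ε , ball  = oP σ σ∈K x x∈σ Px
              δ , 0<δ , ball′ = oQ σ σ∈K x x∈σ Qx
              η , 0<η , η≤ε , η≤δ = minimum 0<ε 0<δ
          in η , 0<η , λ y y∈σ near →
               ball  y y∈σ (λ v v∈σ → Near-mono η≤ε (near v v∈σ)) ,
               ball′ y y∈σ (λ v v∈σ → Near-mono η≤δ (near v v∈σ))
      ; open-⋃        = λ I oP σ σ∈K x x∈σ (i , Px) →
          let ε , 0<ε , ball = oP i σ σ∈K x x∈σ Px
          in ε , 0<ε , λ y y∈σ near → i , ball y y∈σ near
      }

  record MetricSpace : Set₁ where
    field
      Point    : Set
      dist     : Point → Point → Carrier
      isMetric : IsGeneralMetric _≡_ _≈_ _≤_ 0# _+_ dist

    open IsGeneralMetric isMetric public using (≈⇒0)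

  VR : (X : MetricSpace) (r : Carrier) → 0# ≤ r → SimplicialComplex
  VR X r 0≤r = record
    { Vertex    = Point
    ; IsSimplex = λ σ → σ ≢ [] × (∀ x y → x ∈ σ → y ∈ σ → dist x y ≤ r)
    ; nonEmpty  = proj₁
    ; vertex    = λ v → (λ ()) , λ where
        x y (here ≡.refl) (here ≡.refl) → ≤-respˡ (sym (≈⇒0 ≡.refl)) 0≤r
    ; face      = λ (_ , diam) τ⊆σ τ≢[] →
        τ≢[] , λ x y x∈τ y∈τ → diam x y (τ⊆σ x∈τ) (τ⊆σ y∈τ)
    }
    where
    open MetricSpace X

  ℤ^ : ℕ → MetricSpace
  ℤ^ n = record
    { Point    = Vec ℤ n
    ; dist     = λ x y → fromℕ (manhattan x y)
    ; isMetric = record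
        { isSemiMetric = record
            { isQuasiSemiMetric = record
                { isPreMetric = record
                    { isProtoMetric = record
                        { isPartialOrder  = ≤.isPartialOrder
                        ; ≈-isEquivalence = ≡.isEquivalence
                        ; cong            = λ where ≡.refl ≡.refl → refl
                        ; nonNegative     = λ {x} {y} → 0≤fromℕ (manhattan x y)
                        }
                    ; ≈⇒0 = λ {x} x≡y → reflexive (≡.cong fromℕ (manhattan-≡ x x≡y))
                    }
                ; 0⇒≈ = λ {x} {y} eq → manhattan-zero x y (fromℕ≈0⇒≡0 (manhattan x y) eq)
                }
            ; sym = λ x y → reflexive (≡.cong fromℕ (manhattan-sym x y))
            }
        ; triangle = λ x y z →
            ≤-respʳ (fromℕ-+ (manhattan x y) (manhattan y z))
                    (fromℕ-mono (manhattan-triangle x y z))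
        }
    }

  2≤⇒0≤ : ∀ {r} → 2# ≤ r → 0# ≤ r
  2≤⇒0≤ = ≤.trans 0≤2

{-# OPTIONS --safe #-}
module Submission where

-- VR(ℤⁿ; r) is locally finite, so a map into its realization is continuous as soon as
-- all barycentric coordinates are.  Two maps whose values always lie in a common simplex
-- are therefore joined by the straight-line homotopy, and a chain of such maps by a broken
-- line.  A loop γ at x is joined in this way to a constant loop:
--   * by compactness γ shares simplices with an edge path through vertices v₀ , … , v_N;
--   * an edge of length ≤ r lies in one simplex with a coordinatewise lattice path
--     between its ends, and so may be replaced by unit steps;
--   * contracting ℤⁿ onto a point w one coordinate and one unit at a time is 1-Lipschitz
--     and moves every point by at most 1, so it turns unit-step paths into unit-step paths
--     in such a way that the squares swept out have diameter ≤ 2 ≤ r.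
-- The base point x need not be a vertex: all paths keep x as their first and last node,
-- next to a vertex w of its carrier.

open import Defs
open import Algebra.Bundles using (CommutativeRing)
open import Axiom.ExcludedMiddle using (ExcludedMiddle)
open import Data.Empty using (⊥-elim)
open import Data.Integer.Base as ℤ using (ℤ; +_; -[1+_])
open import Data.Integer.Properties as ℤ using ()
open import Data.List.Base as List using (List; []; _∷_)
open import Data.List.Membership.Propositional using (_∈_; _∉_)
open import Data.List.Membership.Propositional.Properties using (∈-deduplicate⁺; ∈-deduplicate⁻; ∈-map⁺; ∈-cartesianProductWith⁺; ∈-upTo⁺; ∈-++⁺ˡ; ∈-++⁺ʳ)
open import Data.List.Relation.Binary.Subset.Propositional using (_⊆_)
open import Data.List.Relation.Unary.All as All using ([]; _∷_)
open import Data.List.Relation.Unary.AllPairs using ([]; _∷_)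
open import Data.List.Relation.Unary.Any using (here; there)
open import Data.List.Relation.Unary.Unique.Propositional using (Unique)
open import Data.Maybe.Base as Maybe using (Maybe)
open import Data.Nat.Base as ℕ using (ℕ; zero; suc; _∸_)
open import Data.Nat.Properties as ℕ using ()
open import Data.Product using (Σ; ∃-syntax; _×_; _,_; proj₁; proj₂)
open import Data.Sum.Base using (_⊎_; inj₁; inj₂)
open import Data.Unit.Base using (tt)
open import Data.Vec.Base as Vec using (Vec; []; _∷_)
open import Function.Base using (_∘_)
open import Function.Metric.Structures using (IsGeneralMetric)
open import Level using (0ℓ; _⊔_) renaming (suc to lsuc)
open import Relation.Binary.Construct.Closure.ReflexiveTransitive as Star using (Star; _◅_)
open import Relation.Binary.Definitions using (DecidableEquality)
open import Relation.Binary.PropositionalEquality as ≡ using (_≡_; _≢_)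
open import Relation.Nullary.Decidable using (yes; no)
open import Relation.Nullary.Negation using (¬_)
open import Relation.Unary using (Pred; U; _∩_)

import Algebra.Properties.Ring as RingProperties
import Algebra.Properties.Semiring.Mult.TCOptimised as Mult
import Algebra.Solver.Ring as Solver
import Algebra.Solver.Ring.AlmostCommutativeRing as ACR
import Data.Integer.Solver as ℤ-Solver
import Data.List.Relation.Unary.Unique.DecPropositional.Properties as UniqueProperties
import Relation.Binary.Reasoning.Setoid as SetoidReasoning
import Relation.Nullary.Decidable as Dec

-- Ordered field arithmetic

-- Why unit steps: an edge of length up to r and its image under one move of the contraction span a
-- square whose diameter is only bounded by r + 1, whereas unit sides give diagonals of length at
-- most 2. Paths are compared index by index. Before it is refined, the coarse edge path is
-- therefore made to wait at each label for as long as the refined one needs to walk the edge; with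
-- an integer R above r, n R steps suffice for every edge. A unit-step path with M steps that starts
-- at w stays within M of w, so n M moves contract it. Broken lines occur twice: in time they turn
-- an edge path into a path, in the deformation parameter they turn a chain of paths into a
-- homotopy. Their coordinates are given by one closed formula, so continuity is never glued from
-- pieces; the simplices, selected by case distinction, only supply carriers and proofs.

module IntegerCoefficients {c ℓ} (R : CommutativeRing c ℓ) where
  open CommutativeRing R
  open RingProperties ring
  open Mult semiring using (1+×; ×-homo-+; ×1-homo-*) renaming (_×_ to _·_)
  open SetoidReasoning setoid

  -- The ring solver has to compare coefficients by computation, which field elements do not allow;
  -- integers do, and they map to every commutative ring. The optimised multiples make `con (+ 1)`
  -- and `con (+ 2)` evaluate to `1#` and `2#` themselves.
  fromℤ : ℤ → Carrier
  fromℤ (+ n)    = n · 1#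
  fromℤ -[1+ n ] = - (suc n · 1#)

  fromℤ-neg : ∀ i → fromℤ (ℤ.- i) ≈ - fromℤ i
  fromℤ-neg (+ zero)  = sym -0#≈0#
  fromℤ-neg (+ suc n) = refl
  fromℤ-neg -[1+ n ]  = sym (-‿involutive _)

  fromℤ-⊖ : ∀ m n → fromℤ (m ℤ.⊖ n) ≈ m · 1# - n · 1#
  fromℤ-⊖ m       zero    = sym (trans (+-congˡ -0#≈0#) (+-identityʳ _))
  fromℤ-⊖ zero    (suc n) = sym (+-identityˡ _)
  fromℤ-⊖ (suc m) (suc n) = begin
    fromℤ (suc m ℤ.⊖ suc n)                ≡⟨ ≡.cong fromℤ (ℤ.[1+m]⊖[1+n]≡m⊖n m n) ⟩
    fromℤ (m ℤ.⊖ n)                        ≈⟨ fromℤ-⊖ m n ⟩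
    m · 1# - n · 1#                        ≈⟨ +-congʳ (trans (+-congʳ (-‿inverseʳ 1#)) (+-identityˡ _)) ⟨
    (1# - 1# + m · 1#) - n · 1#            ≈⟨ +-congʳ (+-assoc 1# (- 1#) (m · 1#)) ⟩
    (1# + (- 1# + m · 1#)) - n · 1#        ≈⟨ +-congʳ (+-congˡ (+-comm (- 1#) (m · 1#))) ⟩
    (1# + (m · 1# - 1#)) - n · 1#          ≈⟨ +-congʳ (+-assoc 1# (m · 1#) (- 1#)) ⟨
    (1# + m · 1# - 1#) - n · 1#            ≈⟨ +-assoc (1# + m · 1#) (- 1#) (- (n · 1#)) ⟩
    1# + m · 1# + (- 1# - n · 1#)          ≈⟨ +-congˡ (-‿+-comm 1# (n · 1#)) ⟩
    1# + m · 1# - (1# + n · 1#)            ≈⟨ +-cong (1+× m 1#) (-‿cong (1+× n 1#)) ⟨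
    suc m · 1# - suc n · 1#                ∎

  fromℤ-+ : ∀ i j → fromℤ (i ℤ.+ j) ≈ fromℤ i + fromℤ j
  fromℤ-+ (+ m)    (+ n)    = ×-homo-+ 1# m n
  fromℤ-+ (+ m)    -[1+ n ] = fromℤ-⊖ m (suc n)
  fromℤ-+ -[1+ m ] (+ n)    = trans (fromℤ-⊖ n (suc m)) (+-comm _ _)
  fromℤ-+ -[1+ m ] -[1+ n ] = begin
    - (suc (suc (m ℕ.+ n)) · 1#)       ≡⟨ ≡.cong (λ k → - (k · 1#)) (≡.cong suc (ℕ.+-suc m n)) ⟨
    - ((suc m ℕ.+ suc n) · 1#)         ≈⟨ -‿cong (×-homo-+ 1# (suc m) (suc n)) ⟩
    - (suc m · 1# + suc n · 1#)        ≈⟨ -‿+-comm _ _ ⟨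
    - (suc m · 1#) - suc n · 1#        ∎

  fromℤ-pos-* : ∀ m j → fromℤ (+ m ℤ.* j) ≈ m · 1# * fromℤ j
  fromℤ-pos-* m (+ n) = begin
    fromℤ (+ m ℤ.* + n)       ≡⟨ ≡.cong fromℤ (ℤ.pos-* m n) ⟨
    (m ℕ.* n) · 1#            ≈⟨ ×1-homo-* m n ⟩
    m · 1# * n · 1#           ∎
  fromℤ-pos-* m -[1+ n ] = begin
    fromℤ (+ m ℤ.* -[1+ n ])          ≡⟨ ≡.cong fromℤ (ℤ.neg-distribʳ-* (+ m) (+ suc n)) ⟨
    fromℤ (ℤ.- (+ m ℤ.* + suc n))     ≈⟨ fromℤ-neg (+ m ℤ.* + suc n) ⟩
    - fromℤ (+ m ℤ.* + suc n)         ≈⟨ -‿cong (fromℤ-pos-* m (+ suc n)) ⟩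
    - (m · 1# * suc n · 1#)           ≈⟨ -‿distribʳ-* _ _ ⟩
    m · 1# * - (suc n · 1#)           ∎
  fromℤ-* : ∀ i j → fromℤ (i ℤ.* j) ≈ fromℤ i * fromℤ j
  fromℤ-* (+ m)    j = fromℤ-pos-* m j
  fromℤ-* -[1+ m ] j = begin
    fromℤ (-[1+ m ] ℤ.* j)            ≡⟨ ≡.cong fromℤ (ℤ.neg-distribˡ-* (+ suc m) j) ⟨
    fromℤ (ℤ.- (+ suc m ℤ.* j))       ≈⟨ fromℤ-neg (+ suc m ℤ.* j) ⟩
    - fromℤ (+ suc m ℤ.* j)           ≈⟨ -‿cong (fromℤ-pos-* (suc m) j) ⟩
    - (suc m · 1# * fromℤ j)          ≈⟨ -‿distribˡ-* _ _ ⟩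
    - (suc m · 1#) * fromℤ j          ∎

  morphism : ℤ.+-*-rawRing ACR.-Raw-AlmostCommutative⟶ ACR.fromCommutativeRing R
  morphism = record
    { ⟦_⟧    = fromℤ
    ; +-homo = fromℤ-+
    ; *-homo = fromℤ-*
    ; -‿homo = fromℤ-neg
    ; 0-homo = refl
    ; 1-homo = refl
    }

  _≟fromℤ_ : ∀ i j → Maybe (fromℤ i ≈ fromℤ j)
  i ≟fromℤ j = Maybe.map (λ i≡j → reflexive (≡.cong fromℤ i≡j)) (Dec.dec⇒maybe (i ℤ.≟ j))

  open Solver ℤ.+-*-rawRing (ACR.fromCommutativeRing R) morphism _≟fromℤ_ public
    using (solve; _:=_; _:+_; _:*_; _:-_; :-_; con)

module FieldArithmetic (em : ExcludedMiddle 0ℓ) (ℝ : CompleteOrderedField) where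
  open CompleteOrderedField ℝ hiding (zero)
  open OrderLemmas ℝ
  open IntegerCoefficients commutativeRing

  abstract
    0≤-+ : ∀ {x y} → 0# ≤ x → 0# ≤ y → 0# ≤ x + y
    0≤-+ {x} {y} p q = ≤.trans p (≤-respˡ (+-identityʳ x) (+-monoʳ-≤ x q))

    ≤⇒0≤- : ∀ {x y} → x ≤ y → 0# ≤ y - x
    ≤⇒0≤- {x} {y} p = ≤-respˡ (-‿inverseʳ x) (+-monoˡ-≤ (- x) p)

    -- Linear arithmetic: x ≤ y is certified by writing y - x as a combination
    -- of quantities known to be nonnegative.
    ≤-by : ∀ {x y d} → 0# ≤ d → x + d ≈ y → x ≤ y
    ≤-by {x} {y} 0≤d eq = ≤-respʳ eq (≤-respˡ (+-identityʳ x) (+-monoʳ-≤ x 0≤d))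

    ≤-reflexive : ∀ {x y} → x ≈ y → x ≤ y
    ≤-reflexive = ≤.reflexive

    <⇒≱ : ∀ {x y} → x < y → ¬ (y ≤ x)
    <⇒≱ (x≤y , x≉y) y≤x = x≉y (≤.antisym x≤y y≤x)

    ≰⇒> : ∀ {x y} → ¬ (x ≤ y) → y < x
    ≰⇒> {x} {y} x≰y with ≤.total x y
    ... | inj₁ x≤y = ⊥-elim (x≰y x≤y)
    ... | inj₂ y≤x = y≤x , λ y≈x → x≰y (≤-reflexive (sym y≈x))

    ≤-or-> : ∀ x y → (x ≤ y) ⊎ (y < x)
    ≤-or-> x y with em {x ≤ y}
    ... | yes x≤y = inj₁ x≤y
    ... | no  x≰y = inj₂ (≰⇒> x≰y)

    ≈0-stable : ∀ {x} → ¬ ¬ (x ≈ 0#) → x ≈ 0#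
    ≈0-stable {x} nn with em {x ≈ 0#}
    ... | yes e = e
    ... | no  n = ⊥-elim (nn n)

    ≤-<-trans : ∀ {x y z} → x ≤ y → y < z → x < z
    ≤-<-trans x≤y y<z = ≰⇒> λ z≤x → <⇒≱ y<z (≤.trans z≤x x≤y)

    +-monoʳ-< : ∀ z {x y} → x < y → z + x < z + y
    +-monoʳ-< z {x} {y} x<y = ≰⇒> λ p → <⇒≱ x<y
      (≤-by (≤⇒0≤- p) (solve 3 (λ x y z → y :+ ((z :+ x) :- (z :+ y)) := x) refl x y z))

    *-monoʳ-≤ : ∀ {z x y} → 0# ≤ z → x ≤ y → z * x ≤ z * y
    *-monoʳ-≤ {z} {x} {y} 0≤z x≤y = ≤-by (*-nonNeg 0≤z (≤⇒0≤- x≤y))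
      (solve 3 (λ x y z → z :* x :+ z :* (y :- x) := z :* y) refl x y z)

    *-pos : ∀ {x y} → 0# < x → 0# < y → 0# < x * y
    *-pos {x} {y} (0≤x , 0≉x) (0≤y , 0≉y) = *-nonNeg 0≤x 0≤y , λ 0≈xy →
      let x⁻¹ , xx⁻¹≈1 = inverse x (λ x≈0 → 0≉x (sym x≈0)) in
      0≉y (trans (sym (zeroˡ x⁻¹)) (trans (*-congʳ 0≈xy)
        (trans (solve 3 (λ x y z → x :* y :* z := x :* z :* y) refl x y x⁻¹)
        (trans (*-congʳ xx⁻¹≈1) (*-identityˡ y)))))

    *-cancelˡ-≤ : ∀ {z x y} → 0# < z → z * x ≤ z * y → x ≤ y
    *-cancelˡ-≤ {z} {x} {y} 0<z zx≤zy with ≤-or-> x y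
    ... | inj₁ x≤y = x≤y
    ... | inj₂ y<x = ⊥-elim (<⇒≱ (*-pos 0<z 0<x-y)
          (≤-by (≤⇒0≤- zx≤zy) (solve 3 (λ x y z → z :* (x :- y) :+ (z :* y :- z :* x) := con (+ 0)) refl x y z)))
      where
      0<x-y : 0# < x - y
      0<x-y = ≰⇒> λ p → <⇒≱ y<x (≤-by (≤⇒0≤- p)
        (solve 2 (λ x y → x :+ (con (+ 0) :- (x :- y)) := y) refl x y))

    inverse-pos : ∀ {x} → 0# < x → ∃[ y ] 0# ≤ y × x * y ≈ 1#
    inverse-pos {x} 0<x with inverse x (λ x≈0 → proj₂ 0<x (sym x≈0))
    ... | y , xy≈1 = y , *-cancelˡ-≤ 0<x (≤-respˡ (sym (zeroʳ x)) (≤-respʳ (sym xy≈1) 0≤1)) , xy≈1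

    half : ∀ {ε} → 0# < ε → ∃[ h ] 0# < h × h + h ≈ ε
    half {ε} 0<ε with inverse-pos {2#} (<-≤-trans 0<1 (≤-respˡ (+-identityʳ 1#) (+-monoʳ-≤ 1# 0≤1)))
    ... | y , 0≤y , 2y≈1 = ε * y , (*-nonNeg (proj₁ 0<ε) 0≤y , λ 0≈εy → proj₂ 0<ε
            (trans (sym (+-identityʳ 0#)) (trans (+-cong 0≈εy 0≈εy) twice))) , twice
      where
      twice : ε * y + ε * y ≈ ε
      twice = trans (solve 2 (λ ε y → ε :* y :+ ε :* y := ε :* (con (+ 2) :* y)) refl ε y)
                    (trans (*-congˡ 2y≈1) (*-identityʳ ε))

    fromℕ-suc : ∀ n → fromℕ (suc n) ≈ fromℕ n + 1#
    fromℕ-suc n = +-comm 1# (fromℕ n)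

    fromℕ-* : ∀ m n → fromℕ (m ℕ.* n) ≈ fromℕ m * fromℕ n
    fromℕ-* zero    n = sym (zeroˡ _)
    fromℕ-* (suc m) n = trans (fromℕ-+ n (m ℕ.* n)) (trans (+-congˡ (fromℕ-* m n))
      (solve 2 (λ a b → a :+ b :* a := (con (+ 1) :+ b) :* a) refl (fromℕ n) (fromℕ m)))

    n<1+n : ∀ n → fromℕ n < fromℕ (suc n)
    n<1+n n = let p , q = x<x+ε (fromℕ n) 0<1 in
      ≤-respʳ (+-comm _ _) p , λ e → q (trans e (+-comm _ _))

    fromℕ-cancel-≤ : ∀ {m n} → fromℕ m ≤ fromℕ n → m ℕ.≤ n
    fromℕ-cancel-≤ {m} {n} p with m ℕ.≤? n
    ... | yes m≤n = m≤n
    ... | no  m≰n = ⊥-elim (<⇒≱ (n<1+n n) (≤.trans (fromℕ-mono (ℕ.≰⇒> m≰n)) p))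

    0<fromℕ : ∀ {n} → 1 ℕ.≤ n → 0# < fromℕ n
    0<fromℕ 1≤n = <-≤-trans (n<1+n 0) (fromℕ-mono 1≤n)

    -- Otherwise c bounds all multiples of δ, which then have a supremum s. The successor of each
    -- multiple is still at most s, so s - δ is a smaller upper bound.
    archimedean : ∀ {δ} → 0# < δ → ∀ c → ∃[ N ] c ≤ fromℕ N * δ
    archimedean {δ} 0<δ c with em {∃[ N ] c ≤ fromℕ N * δ}
    ... | yes p = p
    ... | no ¬p = ⊥-elim (<⇒≱ (x<x+ε s 0<δ) (≤-by (≤⇒0≤- (least (s - δ) below))
          (solve 2 (λ s δ → s :+ δ :+ ((s :- δ) :- s) := s) refl s δ)))
      where
      Multiple : Carrier → Set
      Multiple x = ∃[ N ] x ≈ fromℕ N * δ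
      sup : ∃[ s ] UpperBound Multiple s × (∀ u → UpperBound Multiple u → s ≤ u)
      sup = supremum Multiple (_ , 0 , refl)
        (c , λ x (N , eq) → ≤-respˡ (sym eq) (proj₁ (≰⇒> λ c≤ → ¬p (N , c≤))))
      s : Carrier
      s = proj₁ sup
      least : ∀ u → UpperBound Multiple u → s ≤ u
      least = proj₂ (proj₂ sup)
      below : UpperBound Multiple (s - δ)
      below x (N , eq) = ≤-by (≤⇒0≤- (proj₁ (proj₂ sup) _ (suc N , refl)))
        (trans (+-congʳ eq) (solve 3 (λ n δ s → n :* δ :+ (s :- (con (+ 1) :+ n) :* δ) := s :- δ) refl (fromℕ N) δ s))

  -- A non-strict `Near`: its halves can be certified by `≤-by`, and strictness is recovered by
  -- halving the radius (`Close⇒Near`).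
  Close : Carrier → Carrier → Carrier → Set
  Close ε x y = x ≤ y + ε × y ≤ x + ε

  abstract
    Near⇒Close : ∀ {ε x y} → Near ε x y → Close ε x y
    Near⇒Close ((p , _) , (q , _)) = p , q

    Close⇒Near : ∀ {h ε x y} → 0# < h → h + h ≈ ε → Close h x y → Near ε x y
    Close⇒Near {h} {ε} 0<h 2h≈ε (p , q) = ≤-<-trans p (strict _) , ≤-<-trans q (strict _)
      where
      strict : ∀ z → z + h < z + ε
      strict z = +-monoʳ-< z (≤-respʳ 2h≈ε (proj₁ (x<x+ε h 0<h)) ,
                              λ e → proj₂ (x<x+ε h 0<h) (trans e (sym 2h≈ε)))

    Close-resp : ∀ {ε x x′ y y′} → x ≈ x′ → y ≈ y′ → Close ε x y → Close ε x′ y′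
    Close-resp x≈ y≈ (p , q) = ≤-respˡ x≈ (≤-respʳ (+-congʳ y≈) p) , ≤-respˡ y≈ (≤-respʳ (+-congʳ x≈) q)

    Close⇒≈ : ∀ {x y} → (∀ {ε} → 0# < ε → Close ε x y) → x ≈ y
    Close⇒≈ {x} {y} close = ≤.antisym (below (λ p → proj₁ (close p))) (below (λ p → proj₂ (close p)))
      where
      below : ∀ {x y} → (∀ {ε} → 0# < ε → x ≤ y + ε) → x ≤ y
      below {x} {y} le with ≤-or-> x y
      ... | inj₁ x≤y = x≤y
      ... | inj₂ y<x = ⊥-elim (<⇒≱ 0<h (≤-by (≤⇒0≤- (le 0<h))
            (trans (+-congˡ (+-congˡ (-‿cong x≈))) (solve 2 (λ h y → h :+ (y :+ h :- (y :+ (h :+ h))) := con (+ 0)) refl h y))))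
        where
        gap : 0# < x - y
        gap = ≰⇒> λ p → <⇒≱ y<x (≤-by (≤⇒0≤- p)
          (solve 2 (λ x y → x :+ (con (+ 0) :- (x :- y)) := y) refl x y))
        h : Carrier
        h = proj₁ (half gap)
        0<h : 0# < h
        0<h = proj₁ (proj₂ (half gap))
        x≈ : x ≈ y + (h + h)
        x≈ = trans (solve 2 (λ x y → x := y :+ (x :- y)) refl x y) (+-congˡ (sym (proj₂ (proj₂ (half gap)))))

    Close-+ : ∀ {δ ε a a′ b b′} → Close δ a a′ → Close ε b b′ → Close (δ + ε) (a + b) (a′ + b′)
    Close-+ (p , q) (p′ , q′) = add p p′ , add q q′
      where
      add : ∀ {a a′ b b′ δ ε} → a ≤ a′ + δ → b ≤ b′ + ε → a + b ≤ a′ + b′ + (δ + ε)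
      add {a} {a′} {b} {b′} {δ} {ε} p q = ≤-by (0≤-+ (≤⇒0≤- p) (≤⇒0≤- q))
        (solve 6 (λ a a′ b b′ δ ε → a :+ b :+ ((a′ :+ δ :- a) :+ (b′ :+ ε :- b)) := a′ :+ b′ :+ (δ :+ ε))
          refl a a′ b b′ δ ε)

    Close-neg : ∀ {ε a a′} → Close ε a a′ → Close ε (- a) (- a′)
    Close-neg (p , q) = neg q , neg p
      where
      neg : ∀ {a a′ ε} → a′ ≤ a + ε → - a ≤ - a′ + ε
      neg {a} {a′} {ε} p = ≤-by (≤⇒0≤- p)
        (solve 3 (λ a a′ ε → (:- a) :+ (a :+ ε :- a′) := (:- a′) :+ ε) refl a a′ ε)

  InUnit : Carrier → Set
  InUnit x = 0# ≤ x × x ≤ 1#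

  abstract
    -- On the unit interval multiplication is 1-Lipschitz in each factor, so the error is
    -- independent of the point. Barycentric coordinates and clamped parameters all lie there.
    Close-* : ∀ {ε a a′ b b′} → 0# ≤ ε → InUnit a → InUnit a′ → InUnit b → InUnit b′ →
              Close ε a a′ → Close ε b b′ → Close (ε + ε) (a * b) (a′ * b′)
    Close-* 0≤ε ua ua′ ub ub′ (p , q) (p′ , q′) =
      mul 0≤ε ua ub′ p p′ , mul 0≤ε ua′ ub q q′
      where
      mul : ∀ {ε a a′ b b′} → 0# ≤ ε → InUnit a → InUnit b′ →
            a ≤ a′ + ε → b ≤ b′ + ε → a * b ≤ a′ * b′ + (ε + ε)
      mul {ε} {a} {a′} {b} {b′} 0≤ε (0≤a , a≤1) (0≤b′ , b′≤1) p q = ≤-by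
        (0≤-+ (0≤-+ (*-nonNeg 0≤a (≤⇒0≤- q)) (*-nonNeg (≤⇒0≤- a≤1) 0≤ε))
              (0≤-+ (*-nonNeg 0≤b′ (≤⇒0≤- p)) (*-nonNeg (≤⇒0≤- b′≤1) 0≤ε)))
        (solve 5 (λ a a′ b b′ ε → a :* b :+
          ((a :* (b′ :+ ε :- b) :+ (con (+ 1) :- a) :* ε) :+ (b′ :* (a′ :+ ε :- a) :+ (con (+ 1) :- b′) :* ε))
          := a′ :* b′ :+ (ε :+ ε)) refl a a′ b b′ ε)

  -- The graph of truncation to the unit interval, so that one case split yields both the value and
  -- the reason for it.
  data Clamped (u : Carrier) : Carrier → Set where
    below  : ∀ {c} → u ≤ 0# → c ≈ 0# → Clamped u c
    inside : ∀ {c} → 0# ≤ u → u ≤ 1# → c ≈ u → Clamped u c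
    above  : ∀ {c} → 1# ≤ u → c ≈ 1# → Clamped u c

  clamped : ∀ u → ∃[ c ] Clamped u c
  clamped u with ≤.total u 0# | ≤.total u 1#
  ... | inj₁ u≤0 | _        = 0# , below u≤0 refl
  ... | inj₂ 0≤u | inj₁ u≤1 = u  , inside 0≤u u≤1 refl
  ... | inj₂ 0≤u | inj₂ 1≤u = 1# , above 1≤u refl

  clamp : Carrier → Carrier
  clamp u = proj₁ (clamped u)

  abstract
    clamp-unit : ∀ u → InUnit (clamp u)
    clamp-unit u with clamped u
    ... | c , below _ c≈0      = ≤-reflexive (sym c≈0) , ≤.trans (≤-reflexive c≈0) 0≤1
    ... | c , inside 0≤u u≤1 c≈u = ≤-respʳ (sym c≈u) 0≤u , ≤-respˡ (sym c≈u) u≤1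
    ... | c , above _ c≈1      = ≤-respʳ (sym c≈1) 0≤1 , ≤-reflexive c≈1

    clamp-≤0 : ∀ {u} → u ≤ 0# → clamp u ≈ 0#
    clamp-≤0 {u} u≤0 with clamped u
    ... | c , below _ c≈0        = c≈0
    ... | c , inside 0≤u _ c≈u   = trans c≈u (≤.antisym u≤0 0≤u)
    ... | c , above 1≤u _        = ⊥-elim (<⇒≱ 0<1 (≤.trans 1≤u u≤0))

    clamp-≥1 : ∀ {u} → 1# ≤ u → clamp u ≈ 1#
    clamp-≥1 {u} 1≤u with clamped u
    ... | c , below u≤0 _        = ⊥-elim (<⇒≱ 0<1 (≤.trans 1≤u u≤0))
    ... | c , inside _ u≤1 c≈u   = trans c≈u (≤.antisym u≤1 1≤u)
    ... | c , above _ c≈1        = c≈1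

    clamp-least : ∀ {u y} → 0# ≤ y → u ≤ y → clamp u ≤ y
    clamp-least {u} 0≤y u≤y with clamped u
    ... | c , below _ c≈0      = ≤-respˡ (sym c≈0) 0≤y
    ... | c , inside _ _ c≈u   = ≤-respˡ (sym c≈u) u≤y
    ... | c , above 1≤u c≈1    = ≤-respˡ (sym c≈1) (≤.trans 1≤u u≤y)

    clamp-Close : ∀ {ε u v} → 0# ≤ ε → Close ε u v → Close ε (clamp u) (clamp v)
    clamp-Close 0≤ε (p , q) = one 0≤ε p , one 0≤ε q
      where
      one : ∀ {ε u v} → 0# ≤ ε → u ≤ v + ε → clamp u ≤ clamp v + ε
      one {ε} {u} {v} 0≤ε u≤v+ε with clamped v
      ... | c , below v≤0 c≈0 = clamp-least (0≤-+ (≤-reflexive (sym c≈0)) 0≤ε)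
            (≤.trans u≤v+ε (+-monoˡ-≤ ε (≤-respʳ (sym c≈0) v≤0)))
      ... | c , inside 0≤v _ c≈v = clamp-least (0≤-+ (≤-respʳ (sym c≈v) 0≤v) 0≤ε)
            (≤-respʳ (+-congʳ (sym c≈v)) u≤v+ε)
      ... | c , above _ c≈1 = ≤.trans (proj₂ (clamp-unit u))
            (≤-respˡ (+-identityʳ 1#) (≤.trans (+-monoʳ-≤ 1# 0≤ε) (≤-reflexive (+-congʳ (sym c≈1)))))

-- Continuous real-valued functions and broken lines

module RealValued (em : ExcludedMiddle 0ℓ) (ℝ : CompleteOrderedField) where
  open CompleteOrderedField ℝ hiding (zero)
  open OrderLemmas ℝ
  open FieldArithmetic em ℝ
  open IntegerCoefficients commutativeRing

  module _ {o} (X : Space o) where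
    private
      module X = Space X

    -- Continuity of a real-valued function by neighbourhoods, which avoids turning the field into a
    -- `Space`.
    Continuous : (X.Carrier → Carrier) → Set (lsuc 0ℓ ⊔ o)
    Continuous f = ∀ x {ε} → 0# < ε →
      Σ (Pred X.Carrier 0ℓ) λ V → X.IsOpen V × V x × (∀ {y} → V y → Close ε (f x) (f y))

  module _ {o} {X : Space o} where
    private
      module X = Space X

    -- Open sets are saturated, so y lies in the neighbourhood of x belonging to any ε.
    continuous-cong : ∀ {f} → Continuous X f → ∀ {x y} → x X.≈ y → f x ≈ f y
    continuous-cong cf {x} x≈y = Close⇒≈ λ 0<ε →
      let V , oV , Vx , close = cf x 0<ε in close (X.open-resp oV x≈y Vx)

    continuous-const : ∀ c → Continuous X (λ _ → c)
    continuous-const c x {ε} 0<ε = U , X.open-U , tt , λ _ → let p = proj₁ (x<x+ε c 0<ε) in p , p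

    continuous-+ : ∀ {f g} → Continuous X f → Continuous X g → Continuous X (λ x → f x + g x)
    continuous-+ cf cg x 0<ε with half 0<ε
    ... | h , 0<h , 2h≈ε =
      let V , oV , Vx , closeV = cf x 0<h
          W , oW , Wx , closeW = cg x 0<h
      in V ∩ W , X.open-∩ oV oW , (Vx , Wx) , λ (Vy , Wy) →
         let p , q = Close-+ (closeV Vy) (closeW Wy)
         in ≤-respʳ (+-congˡ 2h≈ε) p , ≤-respʳ (+-congˡ 2h≈ε) q

    continuous-neg : ∀ {f} → Continuous X f → Continuous X (λ x → - f x)
    continuous-neg cf x 0<ε =
      let V , oV , Vx , close = cf x 0<ε in V , oV , Vx , λ Vy → Close-neg (close Vy)

    continuous-* : ∀ {f g} → (∀ x → InUnit (f x)) → (∀ x → InUnit (g x)) →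
                   Continuous X f → Continuous X g → Continuous X (λ x → f x * g x)
    continuous-* uf ug cf cg x 0<ε with half 0<ε
    ... | h , 0<h , 2h≈ε =
      let V , oV , Vx , closeV = cf x 0<h
          W , oW , Wx , closeW = cg x 0<h
      in V ∩ W , X.open-∩ oV oW , (Vx , Wx) , λ {y} (Vy , Wy) →
         let p , q = Close-* (proj₁ 0<h) (uf x) (uf y) (ug x) (ug y) (closeV Vy) (closeW Wy)
         in ≤-respʳ (+-congˡ 2h≈ε) p , ≤-respʳ (+-congˡ 2h≈ε) q

    continuous-clamp : ∀ {f} → Continuous X f → Continuous X (λ x → clamp (f x))
    continuous-clamp cf x 0<ε =
      let V , oV , Vx , close = cf x 0<ε in V , oV , Vx , λ Vy → clamp-Close (proj₁ 0<ε) (close Vy)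

    continuous-≈ : ∀ {f g} → (∀ x → f x ≈ g x) → Continuous X f → Continuous X g
    continuous-≈ f≈g cf x 0<ε =
      let V , oV , Vx , close = cf x 0<ε in V , oV , Vx , λ {y} Vy → Close-resp (f≈g x) (f≈g y) (close Vy)

    -- By repeated addition, since `continuous-*` covers only factors with values in the unit
    -- interval.
    continuous-fromℕ* : ∀ n {f} → Continuous X f → Continuous X (λ x → fromℕ n * f x)
    continuous-fromℕ* zero    cf = continuous-≈ (λ _ → sym (zeroˡ _)) (continuous-const 0#)
    continuous-fromℕ* (suc n) {f} cf = continuous-≈
      (λ x → solve 2 (λ n f → f :+ n :* f := (con (+ 1) :+ n) :* f) refl (fromℕ n) (f x))
      (continuous-+ cf (continuous-fromℕ* n cf))

    continuous-list : ∀ {A : Set} (f : A → X.Carrier → Carrier) (B : List A) →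
                      (∀ a → Continuous X (f a)) → ∀ x {ε} → 0# < ε →
                      Σ (Pred X.Carrier 0ℓ) λ V → X.IsOpen V × V x ×
                      (∀ {y} → V y → ∀ a → a ∈ B → Close ε (f a x) (f a y))
    continuous-list f []      cf x 0<ε = U , X.open-U , tt , λ _ _ ()
    continuous-list f (b ∷ B) cf x 0<ε =
      let V , oV , Vx , closeV = cf b x 0<ε
          W , oW , Wx , closeW = continuous-list f B cf x 0<ε
      in V ∩ W , X.open-∩ oV oW , (Vx , Wx) , λ where
           (Vy , Wy) a (here ≡.refl)  → closeV Vy
           (Vy , Wy) a (there a∈B)    → closeW Wy a a∈B

    continuous-∘ : ∀ {p} {Y : Space p} (φ : ContinuousMap X Y) {f} →
                   Continuous Y f → Continuous X (λ x → f (φ ⟨$⟩ x))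
    continuous-∘ φ cf x 0<ε =
      let V , oV , Vx , close = cf (φ ⟨$⟩ x) 0<ε
      in (λ y → V (φ ⟨$⟩ y)) , ContinuousMap.continuous φ V oV , Vx , λ Vy → close Vy

  module _ {o p} {X : Space o} {Y : Space p} where
    private
      module X = Space X
      module Y = Space Y

    continuous-proj₁ : ∀ {f} → Continuous X f → Continuous (X ×ₛ Y) (λ (x , _) → f x)
    continuous-proj₁ cf (x , y) 0<ε =
      let V , oV , Vx , close = cf x 0<ε
      in (λ (x , _) → V x) ,
         (λ x y Vx → V , U , oV , Y.open-U , Vx , tt , λ _ _ v _ → v) , Vx , λ Vx → close Vx

    continuous-proj₂ : ∀ {f} → Continuous Y f → Continuous (X ×ₛ Y) (λ (_ , y) → f y)
    continuous-proj₂ cf (x , y) 0<ε =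
      let V , oV , Vy , close = cf y 0<ε
      in (λ (_ , y) → V y) ,
         (λ x y Vy → U , V , X.open-U , oV , tt , Vy , λ _ _ _ v → v) , Vy , λ Vy → close Vy

  abstract
    -- A strict inequality survives perturbations smaller than its slack.
    Near-open : ∀ {ε x y} → Near ε x y → ∃[ η ] 0# < η × (∀ {z} → Near η y z → Near ε x z)
    Near-open {ε} {x} {y} (p , q) with minimum (slack p) (slack q)
      where
      slack : ∀ {a b} → a < b → 0# < b - a
      slack {a} {b} a<b = ≰⇒> λ p → <⇒≱ a<b (≤-by (≤⇒0≤- p)
        (solve 2 (λ a b → b :+ (con (+ 0) :- (b :- a)) := a) refl a b))
    ... | η , 0<η , η≤ , η≤′ = η , 0<η , λ {z} (p′ , q′) →
      (≰⇒> λ r → <⇒≱ p′ (≤-by (0≤-+ (≤⇒0≤- η≤) (≤⇒0≤- r))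
        (solve 5 (λ x y z ε η → z :+ η :+ (((y :+ ε :- x) :- η) :+ (x :- (z :+ ε))) := y) refl x y z ε η))) ,
      (≰⇒> λ r → <⇒≱ q′ (≤-by (0≤-+ (≤⇒0≤- η≤′) (≤⇒0≤- r))
        (solve 5 (λ x y z ε η → y :+ η :+ (((x :+ ε :- y) :- η) :+ (z :- (x :+ ε))) := z) refl x y z ε η)))

  continuous-value : Continuous (UnitInterval ℝ) value
  continuous-value x {ε} 0<ε =
    (λ y → Near ε (value x) (value y)) ,
    (λ y near → let η , 0<η , ball = Near-open near in η , 0<η , λ z → ball) ,
    ≈⇒Near 0<ε refl , Near⇒Close

  sum : ∀ {A : Set} → (A → Carrier) → List A → Carrier
  sum f A = List.foldr _+_ 0# (List.map f A)

  module _ {A : Set} where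

    abstract
      remove : ∀ (f : A → Carrier) {a B} → a ∈ B → Unique B →
               ∃[ B′ ] Unique B′ × a ∉ B′ × B′ ⊆ B ×
               (∀ {v} → v ∈ B → v ≡ a ⊎ v ∈ B′) × sum f B ≈ f a + sum f B′
      remove f {B = b ∷ B} (here ≡.refl) (b∉B ∷ uB) =
        B , uB , (λ b∈B → All.lookup b∉B b∈B ≡.refl) , there ,
        (λ { (here v≡b) → inj₁ v≡b ; (there v∈B) → inj₂ v∈B }) , refl
      remove f {a} {b ∷ B} (there a∈B) (b∉B ∷ uB) =
        let B′ , uB′ , a∉B′ , B′⊆B , split , eq = remove f a∈B uB in
        b ∷ B′ , All.tabulate (λ v∈B′ → All.lookup b∉B (B′⊆B v∈B′)) ∷ uB′ ,
        (λ { (here a≡b) → All.lookup b∉B a∈B (≡.sym a≡b) ; (there a∈B′) → a∉B′ a∈B′ }) ,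
        (λ { (here e) → here e ; (there v∈) → there (B′⊆B v∈) }) ,
        (λ { (here e) → inj₂ (here e)
           ; (there v∈) → case-split (split v∈) }) ,
        trans (+-congˡ eq) (solve 3 (λ a b s → b :+ (a :+ s) := a :+ (b :+ s)) refl (f a) (f b) (sum f B′))
        where
        case-split : ∀ {v B′} → v ≡ a ⊎ v ∈ B′ → v ≡ a ⊎ v ∈ b ∷ B′
        case-split (inj₁ e)  = inj₁ e
        case-split (inj₂ v∈) = inj₂ (there v∈)

      sum-zero : ∀ (f : A → Carrier) B → (∀ v → v ∈ B → f v ≈ 0#) → sum f B ≈ 0#
      sum-zero f []      _ = refl
      sum-zero f (b ∷ B) z = trans (+-cong (z b (here ≡.refl)) (sum-zero f B (λ v → z v ∘ there))) (+-identityˡ 0#)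

      -- This frees the total mass of a point from its carrier: `sum-coord` computes it over any
      -- duplicate-free list outside which the coordinates vanish.
      sum-unique : ∀ (f : A → Carrier) {A B} → Unique A → Unique B →
                   (∀ v → v ∈ A → v ∉ B → f v ≈ 0#) → (∀ v → v ∈ B → v ∉ A → f v ≈ 0#) →
                   sum f A ≈ sum f B
      sum-unique f {[]} {B} _ _ _ zB = sym (sum-zero f B (λ v v∈ → zB v v∈ λ ()))
      sum-unique f {a ∷ A} {B} (a∉A ∷ uA) uB zA zB with em {a ∈ B}
      ... | no a∉B = trans (+-cong (zA a (here ≡.refl) a∉B) (sum-unique f uA uB (λ v → zA v ∘ there) zB′)) (+-identityˡ _)
        where
        zB′ : ∀ v → v ∈ B → v ∉ A → f v ≈ 0#
        zB′ v v∈B v∉A = zB v v∈B λ { (here ≡.refl) → a∉B v∈B ; (there v∈A) → v∉A v∈A }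
      ... | yes a∈B = let B′ , uB′ , a∉B′ , B′⊆B , split , eq = remove f a∈B uB in
        trans (+-congˡ (sum-unique f uA uB′
          (λ v v∈A v∉B′ → zA v (there v∈A) λ v∈B → contra v∈A v∉B′ (split v∈B))
          (λ v v∈B′ v∉A → zB v (B′⊆B v∈B′) λ { (here ≡.refl) → a∉B′ v∈B′ ; (there v∈A) → v∉A v∈A })))
          (sym eq)
        where
        contra : ∀ {v B′} → v ∈ A → v ∉ B′ → ¬ (v ≡ a ⊎ v ∈ B′)
        contra v∈A v∉B′ (inj₁ ≡.refl) = All.lookup a∉A v∈A ≡.refl
        contra v∈A v∉B′ (inj₂ v∈B′)   = v∉B′ v∈B′

      sum-≈ : ∀ {f g : A → Carrier} → (∀ v → f v ≈ g v) → ∀ B → sum f B ≈ sum g B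
      sum-≈ f≈g []      = refl
      sum-≈ f≈g (b ∷ B) = +-cong (f≈g b) (sum-≈ f≈g B)

      sum-segment : ∀ (f g : A → Carrier) θ B →
                    sum (λ v → f v + θ * (g v - f v)) B ≈ sum f B + θ * (sum g B - sum f B)
      sum-segment f g θ []      = solve 1 (λ θ → con (+ 0) := con (+ 0) :+ θ :* (con (+ 0) :- con (+ 0))) refl θ
      sum-segment f g θ (b ∷ B) = trans (+-congˡ (sum-segment f g θ B))
        (solve 5 (λ a c θ s t → a :+ θ :* (c :- a) :+ (s :+ θ :* (t :- s)) := a :+ s :+ θ :* (c :+ t :- (a :+ s)))
          refl (f b) (g b) θ (sum f B) (sum g B))

      0≤sum : ∀ (f : A → Carrier) → (∀ v → 0# ≤ f v) → ∀ B → 0# ≤ sum f B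
      0≤sum f 0≤f []      = ≤.refl
      0≤sum f 0≤f (b ∷ B) = 0≤-+ (0≤f b) (0≤sum f 0≤f B)

      ≤sum : ∀ (f : A → Carrier) → (∀ v → 0# ≤ f v) → ∀ {v B} → v ∈ B → f v ≤ sum f B
      ≤sum f 0≤f {B = b ∷ B} (here ≡.refl) = ≤-respˡ (+-identityʳ _) (+-monoʳ-≤ (f b) (0≤sum f 0≤f B))
      ≤sum f 0≤f {B = b ∷ B} (there v∈B)   =
        ≤.trans (≤sum f 0≤f v∈B) (≤-respˡ (+-identityˡ _) (+-monoˡ-≤ (sum f B) (0≤f b)))

      sum≉0 : ∀ (f : A → Carrier) B → ¬ (sum f B ≈ 0#) → ∃[ v ] v ∈ B × ¬ (f v ≈ 0#)
      sum≉0 f B s≉0 with em {∃[ v ] v ∈ B × ¬ (f v ≈ 0#)}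
      ... | yes p = p
      ... | no ¬p = ⊥-elim (s≉0 (sum-zero f B λ v v∈B → ≈0-stable λ fv≉0 → ¬p (v , v∈B , fv≉0)))

  -- The value at u of the broken line through c 0 , … , c n, taken at unit speed.
  broken : (ℕ → Carrier) → ℕ → Carrier → Carrier
  broken c zero    u = c 0
  -- The product is distributed over the difference because `continuous-*` wants factors in the unit
  -- interval, where a difference of coordinates need not lie.
  broken c (suc n) u = broken c n u + (ρ * c (suc n) - ρ * c n)
    where
    ρ : Carrier
    ρ = clamp (u - fromℕ n)

  abstract
    ≤⇒-≤0 : ∀ {u x} → u ≤ x → u - x ≤ 0#
    ≤⇒-≤0 {u} {x} p = ≤-by (≤⇒0≤- p) (solve 2 (λ u x → u :- x :+ (x :- u) := con (+ 0)) refl u x)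

    broken-≤0 : ∀ c n {u} → u ≤ 0# → broken c n u ≈ c 0
    broken-≤0 c zero    u≤0 = refl
    broken-≤0 c (suc n) {u} u≤0 = trans (+-cong (broken-≤0 c n u≤0)
        (+-cong (*-congʳ ρ≈0) (-‿cong (*-congʳ ρ≈0))))
        (solve 3 (λ a b c → a :+ (con (+ 0) :* b :- con (+ 0) :* c) := a) refl (c 0) (c (suc n)) (c n))
      where
      ρ≈0 : clamp (u - fromℕ n) ≈ 0#
      ρ≈0 = clamp-≤0 (≤⇒-≤0 (≤.trans u≤0 (0≤fromℕ n)))

    broken-≥ : ∀ c n {u} → fromℕ n ≤ u → broken c n u ≈ c n
    broken-≥ c zero    _ = refl
    broken-≥ c (suc n) {u} 1+n≤u = trans (+-cong (broken-≥ c n (≤.trans (proj₁ (n<1+n n)) 1+n≤u))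
        (+-cong (*-congʳ ρ≈1) (-‿cong (*-congʳ ρ≈1))))
        (solve 2 (λ b c → c :+ (con (+ 1) :* b :- con (+ 1) :* c) := b) refl (c (suc n)) (c n))
      where
      ρ≈1 : clamp (u - fromℕ n) ≈ 1#
      ρ≈1 = clamp-≥1 (≤-by (≤⇒0≤- 1+n≤u)
        (solve 2 (λ n u → con (+ 1) :+ (u :- (con (+ 1) :+ n)) := u :- n) refl (fromℕ n) u))

    -- Increments before the j-th are complete and telescope to c j; those after it have parameter
    -- clamped to 0.
    broken-segment : ∀ c n j {u} → j ℕ.< n → fromℕ j ≤ u → u ≤ fromℕ (suc j) →
                     broken c n u ≈ c j + clamp (u - fromℕ j) * (c (suc j) - c j)
    broken-segment c (suc n) j {u} j<1+n j≤u u≤1+j with ℕ.m≤n⇒m<n∨m≡n (ℕ.s≤s⁻¹ j<1+n)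
    ... | inj₂ ≡.refl = trans (+-congʳ (broken-≥ c j j≤u))
          (solve 3 (λ ρ a b → a :+ (ρ :* b :- ρ :* a) := a :+ ρ :* (b :- a)) refl (clamp (u - fromℕ j)) (c j) (c (suc j)))
    ... | inj₁ j<n = trans (+-cong (broken-segment c n j j<n j≤u u≤1+j)
        (+-cong (*-congʳ ρ≈0) (-‿cong (*-congʳ ρ≈0))))
        (solve 3 (λ a b c → a :+ (con (+ 0) :* b :- con (+ 0) :* c) := a) refl _ (c (suc n)) (c n))
      where
      ρ≈0 : clamp (u - fromℕ n) ≈ 0#
      ρ≈0 = clamp-≤0 (≤⇒-≤0 (≤.trans u≤1+j (fromℕ-mono j<n)))

    broken-const : ∀ c n {u a} → (∀ i → c i ≈ a) → broken c n u ≈ a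
    broken-const c zero    c≈a = c≈a 0
    broken-const c (suc n) {u} {a} c≈a = trans (+-cong (broken-const c n c≈a)
      (+-cong (*-congˡ (c≈a (suc n))) (-‿cong (*-congˡ (c≈a n)))))
      (trans (+-congˡ (-‿inverseʳ _)) (+-identityʳ a))

    segment-index : ∀ n {u} → 1 ℕ.≤ n → 0# ≤ u → u ≤ fromℕ n →
                    ∃[ j ] j ℕ.< n × fromℕ j ≤ u × u ≤ fromℕ (suc j)
    segment-index (suc n) _ = go n
      where
      go : ∀ n {u} → 0# ≤ u → u ≤ fromℕ (suc n) →
           ∃[ j ] j ℕ.< suc n × fromℕ j ≤ u × u ≤ fromℕ (suc j)
      go zero    0≤u u≤1 = 0 , ℕ.s≤s ℕ.z≤n , 0≤u , u≤1
      go (suc n) {u} 0≤u u≤2+n with ≤.total u (fromℕ (suc n))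
      ... | inj₂ 1+n≤u = suc n , ℕ.≤-refl , 1+n≤u , u≤2+n
      ... | inj₁ u≤1+n = let j , j<n , p , q = go n 0≤u u≤1+n in j , ℕ.m≤n⇒m≤1+n j<n , p , q

    continuous-broken : ∀ {o} {X : Space o} {u} (c : ℕ → Space.Carrier X → Carrier) n →
                        (∀ i x → InUnit (c i x)) → (∀ i → Continuous X (c i)) → Continuous X u →
                        Continuous X (λ x → broken (λ i → c i x) n (u x))
    continuous-broken c zero    uc cc cu = cc 0
    continuous-broken {X = X} {u} c (suc n) uc cc cu = continuous-+ {X = X} (continuous-broken {X = X} {u} c n uc cc cu)
        (continuous-+ {X = X} (term (suc n)) (continuous-neg {X = X} (term n)))
      where
      term : ∀ i → Continuous X (λ x → clamp (u x - fromℕ n) * c i x)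
      term i = continuous-* {X = X} (λ x → clamp-unit _) (uc i)
        (continuous-clamp {X = X} (continuous-+ {X = X} cu (continuous-const {X = X} (- fromℕ n)))) (cc i)

-- Realizations of locally finite complexes

LocallyFinite : SimplicialComplex → Set
LocallyFinite K = ∀ w → ∃[ B ] (∀ {σ} → IsSimplex σ → w ∈ σ → σ ⊆ B)
  where open SimplicialComplex K

module LocallyFiniteRealization (em : ExcludedMiddle 0ℓ) (ℝ : CompleteOrderedField)
  (K : SimplicialComplex) (locallyFinite : LocallyFinite K) where
  open CompleteOrderedField ℝ hiding (zero)
  open OrderLemmas ℝ
  open FieldArithmetic em ℝ
  open RealValued em ℝ
  open IntegerCoefficients commutativeRing
  open SimplicialComplex K
  open RealizationPoint

  ∣K∣ : Space 0ℓ
  ∣K∣ = Realization ℝ K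

  Pt : Set
  Pt = RealizationPoint ℝ K

  In : List Vertex → Pt → Set
  In = InClosedSimplex ℝ K

  support⊆carrier : ∀ (p : Pt) {v} → ¬ (coord p v ≈ 0#) → v ∈ carrier p
  support⊆carrier p {v} pv≉0 with em {v ∈ carrier p}
  ... | yes v∈ = v∈
  ... | no  v∉ = ⊥-elim (pv≉0 (supported p v v∉))

  support-nonempty : ∀ (p : Pt) → ∃[ w ] ¬ (coord p w ≈ 0#)
  support-nonempty p =
    let w , _ , pw≉0 = sum≉0 (coord p) (carrier p) (λ s≈0 → 0≉1 (trans (sym s≈0) (sum≈1 p))) in w , pw≉0

  coord-unit : ∀ (p : Pt) v → InUnit (coord p v)
  coord-unit p v with em {v ∈ carrier p}
  ... | yes v∈ = 0≤coord p v , ≤-respʳ (sum≈1 p) (≤sum (coord p) (0≤coord p) v∈)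
  ... | no  v∉ = 0≤coord p v , ≤.trans (≤-reflexive (supported p v v∉)) 0≤1

  continuous-coord : ∀ v → Continuous ∣K∣ (λ p → coord p v)
  continuous-coord v p {ε} 0<ε =
    (λ q → Near ε (coord p v) (coord q v)) , ball-open , ≈⇒Near 0<ε refl , Near⇒Close
    where
    ball-open : Space.IsOpen ∣K∣ (λ q → Near ε (coord p v) (coord q v))
    ball-open σ _ q q∈σ near with Near-open near
    ... | η , 0<η , ball = η , 0<η , λ q′ q′∈σ near′ → ball (at q′ q′∈σ near′)
      where
      at : ∀ q′ → In σ q′ → (∀ v → v ∈ σ → Near η (coord q v) (coord q′ v)) → Near η (coord q v) (coord q′ v)
      at q′ q′∈σ near′ with em {v ∈ σ}
      ... | yes v∈σ = near′ v v∈σ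
      ... | no  v∉σ = ≈⇒Near 0<η (trans (q∈σ v v∉σ) (sym (q′∈σ v v∉σ)))

  private
    _≟_ : DecidableEquality Vertex
    _ ≟ _ = em

  sum-coord : ∀ (p : Pt) {σ} → Unique σ → In σ p → sum (coord p) σ ≈ 1#
  sum-coord p {σ} uσ p∈σ = trans (sum-unique (coord p) uσ (unique p)
    (λ v _ v∉ → supported p v v∉) (λ v _ v∉ → p∈σ v v∉)) (sum≈1 p)

  -- Evidence, by convexity of the closed simplex σ, that a coordinate function obtained elsewhere
  -- is that of a point of σ.
  record OnSegment (σ : List Vertex) (c : Vertex → Carrier) : Set where
    field
      start end : Pt
      start∈σ   : In σ start
      end∈σ     : In σ end
      ratio     : Carrier
      ratio∈    : InUnit ratio
      onSegment : ∀ v → c v ≈ coord start v + ratio * (coord end v - coord start v)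

  onSegment-zero : ∀ {σ c} → OnSegment σ c → ∀ v → v ∉ σ → c v ≈ 0#
  onSegment-zero s v v∉σ = trans (onSegment v)
      (trans (+-cong (start∈σ v v∉σ) (*-congˡ (+-cong (end∈σ v v∉σ) (-‿cong (start∈σ v v∉σ)))))
             (solve 1 (λ θ → con (+ 0) :+ θ :* (con (+ 0) :- con (+ 0)) := con (+ 0)) refl ratio))
    where open OnSegment s

  segmentPoint : ∀ {σ} (c : Vertex → Carrier) → IsSimplex σ → OnSegment σ c → Pt
  segmentPoint {σ} c σ∈K s = record
    { coord     = c
    ; carrier   = τ
    ; isSimplex = face σ∈K (∈-deduplicate⁻ _≟_ σ) (τ≢[] σ (nonEmpty σ∈K))
    ; unique    = uτ
    ; supported = λ v v∉τ → onSegment-zero s v (λ v∈σ → v∉τ (∈-deduplicate⁺ _≟_ v∈σ))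
    ; 0≤coord   = λ v → ≤-respʳ (sym (onSegment v)) (≤-respʳ
        (solve 3 (λ θ a b → (con (+ 1) :- θ) :* a :+ θ :* b := a :+ θ :* (b :- a)) refl ratio (coord start v) (coord end v))
        (0≤-+ (*-nonNeg (≤⇒0≤- (proj₂ ratio∈)) (0≤coord start v)) (*-nonNeg (proj₁ ratio∈) (0≤coord end v))))
    ; sum≈1     = trans (sum-≈ onSegment τ) (trans (sum-segment (coord start) (coord end) ratio τ)
        (trans (+-cong Σstart (*-congˡ (+-cong Σend (-‿cong Σstart))))
          (solve 1 (λ θ → con (+ 1) :+ θ :* (con (+ 1) :- con (+ 1)) := con (+ 1)) refl ratio)))
    }
    where
    open OnSegment s
    τ : List Vertex
    τ = List.deduplicate _≟_ σ
    uτ : Unique τ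
    uτ = UniqueProperties.deduplicate-! _≟_ σ
    τ≢[] : ∀ σ → σ ≢ [] → List.deduplicate _≟_ σ ≢ []
    τ≢[] []      σ≢[] = λ _ → σ≢[] ≡.refl
    τ≢[] (_ ∷ _) _    ()
    in-τ : ∀ {p} → In σ p → In τ p
    in-τ p∈σ v v∉τ = p∈σ v (λ v∈σ → v∉τ (∈-deduplicate⁺ _≟_ v∈σ))
    Σstart : sum (coord start) τ ≈ 1#
    Σstart = sum-coord start uτ (in-τ {start} start∈σ)
    Σend : sum (coord end) τ ≈ 1#
    Σend = sum-coord end uτ (in-τ {end} end∈σ)

  -- Only finitely many simplices contain a given vertex of p, so that one radius works
  -- for all of those that contain p.
  private
    uniform : ∀ {P} → Space.IsOpen ∣K∣ P → ∀ p → P p → ∀ A B → A ≢ [] →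
              ∃[ ε ] 0# < ε × (∀ q → A ⊆ carrier q →
                (∀ v → ¬ (coord q v ≈ 0#) → v ∈ A ⊎ v ∈ B) →
                (∀ v → ¬ (coord p v ≈ 0#) → ¬ (coord q v ≈ 0#)) →
                (∀ v → v ∈ A ⊎ v ∈ B → Near ε (coord p v) (coord q v)) → P q)
    uniform {P} oP p Pp A [] A≢[] with em {IsSimplex A × In A p}
    ... | yes (A∈K , p∈A) =
          let ε , 0<ε , ball = oP A A∈K p p∈A Pp in
          ε , 0<ε , λ q _ q⊆ _ near → ball q (in-A q q⊆) (λ v v∈A → near v (inj₁ v∈A))
      where
      in-A : ∀ q → (∀ v → ¬ (coord q v ≈ 0#) → v ∈ A ⊎ v ∈ []) → In A q
      in-A q q⊆ v v∉A = ≈0-stable λ qv≉0 → absurd (q⊆ v qv≉0)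
        where
        absurd : ¬ (v ∈ A ⊎ v ∈ [])
        absurd (inj₁ v∈A) = v∉A v∈A
    -- Any radius will do here: an admissible q would make A a face of its carrier and put the
    -- support of p inside A.
    ... | no ¬A = 1# , 0<1 , λ q A⊆ q⊆ p⊆q _ →
          ⊥-elim (¬A (face (isSimplex q) A⊆ A≢[] , λ v v∉A → ≈0-stable λ pv≉0 → absurd v∉A (q⊆ v (p⊆q v pv≉0))))
      where
      absurd : ∀ {v} → v ∉ A → ¬ (v ∈ A ⊎ v ∈ [])
      absurd v∉A (inj₁ v∈A) = v∉A v∈A
    -- A holds the vertices already assumed to be in the carrier of q, the second list the undecided
    -- ones. Deciding b either way gives two radii, and the smaller one serves both.
    uniform {P} oP p Pp A (b ∷ B) A≢[]
      with uniform oP p Pp A B A≢[] | uniform oP p Pp (b ∷ A) B (λ ())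
    ... | ε , 0<ε , without-b | δ , 0<δ , with-b with minimum 0<ε 0<δ
    ... | η , 0<η , η≤ε , η≤δ = η , 0<η , conclude
      where
      insert : ∀ {v} → v ∈ A ⊎ v ∈ b ∷ B → v ∈ b ∷ A ⊎ v ∈ B
      insert (inj₁ v∈A)         = inj₁ (there v∈A)
      insert (inj₂ (here e))    = inj₁ (here e)
      insert (inj₂ (there v∈B)) = inj₂ v∈B
      insert⁻ : ∀ {v} → v ∈ b ∷ A ⊎ v ∈ B → v ∈ A ⊎ v ∈ b ∷ B
      insert⁻ (inj₁ (here e))    = inj₂ (here e)
      insert⁻ (inj₁ (there v∈A)) = inj₁ v∈A
      insert⁻ (inj₂ v∈B)         = inj₂ (there v∈B)
      weaken : ∀ {v} → v ∈ A ⊎ v ∈ B → v ∈ A ⊎ v ∈ b ∷ B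
      weaken (inj₁ v∈A) = inj₁ v∈A
      weaken (inj₂ v∈B) = inj₂ (there v∈B)
      omit : ∀ {v} → v ≢ b → v ∈ A ⊎ v ∈ b ∷ B → v ∈ A ⊎ v ∈ B
      omit v≢b (inj₁ v∈A)         = inj₁ v∈A
      omit v≢b (inj₂ (here v≡b))  = ⊥-elim (v≢b v≡b)
      omit v≢b (inj₂ (there v∈B)) = inj₂ v∈B
      conclude : ∀ q → A ⊆ carrier q → (∀ v → ¬ (coord q v ≈ 0#) → v ∈ A ⊎ v ∈ b ∷ B) →
                 (∀ v → ¬ (coord p v ≈ 0#) → ¬ (coord q v ≈ 0#)) →
                 (∀ v → v ∈ A ⊎ v ∈ b ∷ B → Near η (coord p v) (coord q v)) → P q
      conclude q A⊆ q⊆ p⊆q near with em {b ∈ carrier q}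
      ... | yes b∈ = with-b q (λ { (here ≡.refl) → b∈ ; (there v∈A) → A⊆ v∈A })
            (λ v qv≉0 → insert (q⊆ v qv≉0)) p⊆q (λ v v∈ → Near-mono η≤δ (near v (insert⁻ v∈)))
      ... | no  b∉ = without-b q A⊆
            (λ v qv≉0 → omit (λ { ≡.refl → qv≉0 (supported q b b∉) }) (q⊆ v qv≉0)) p⊆q
            (λ v v∈ → Near-mono η≤ε (near v (weaken v∈)))

    least-positive : ∀ (p : Pt) B → ∃[ η ] 0# < η × (∀ v → v ∈ B → ¬ (coord p v ≈ 0#) → η ≤ coord p v)
    least-positive p []      = 1# , 0<1 , λ _ ()
    least-positive p (b ∷ B) with least-positive p B | em {coord p b ≈ 0#}
    ... | η , 0<η , le | yes pb≈0 = η , 0<η , λ where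
            v (here ≡.refl) pv≉0 → ⊥-elim (pv≉0 pb≈0)
            v (there v∈B)   pv≉0 → le v v∈B pv≉0
    ... | η , 0<η , le | no pb≉0 with minimum 0<η (0≤coord p b , λ e → pb≉0 (sym e))
    ... | θ , 0<θ , θ≤η , θ≤pb = θ , 0<θ , λ where
            v (here ≡.refl) _    → θ≤pb
            v (there v∈B)   pv≉0 → ≤.trans θ≤η (le v v∈B pv≉0)

    near-positive : ∀ {η a b} → Near η a b → η ≤ a → ¬ (b ≈ 0#)
    near-positive {η} {a} {b} (a<b+η , _) η≤a b≈0 =
      <⇒≱ a<b+η (≤-respˡ (sym (trans (+-congʳ b≈0) (+-identityˡ η))) η≤a)

  -- Local finiteness makes the weak topology coincide with the coordinatewise one.
  module _ {o} (X : Space o) where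
    private
      module X = Space X

    -- The nonzero coordinates of F x sit on its finite carrier, so they have a common positive
    -- lower bound, which a small perturbation cannot cancel.
    support-lower-semicontinuous : (F : X.Carrier → Pt) → (∀ v → Continuous X (λ x → coord (F x) v)) →
      ∀ x → Σ (Pred X.Carrier 0ℓ) λ V → X.IsOpen V × V x ×
      (∀ {y} → V y → ∀ v → ¬ (coord (F x) v ≈ 0#) → ¬ (coord (F y) v ≈ 0#))
    support-lower-semicontinuous F cF x with least-positive (F x) (carrier (F x))
    ... | η , 0<η , le with half 0<η
    ... | h , 0<h , 2h≈η =
      let V , oV , Vx , close = continuous-list {X = X} (λ v x → coord (F x) v) (carrier (F x)) cF x 0<h in
      V , oV , Vx , λ Vy v Fxv≉0 → let v∈ = support⊆carrier (F x) Fxv≉0 in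
        near-positive (Close⇒Near 0<h 2h≈η (close Vy v v∈)) (le v v∈ Fxv≉0)

    -- A vertex w of the support of F x stays in the support nearby, so nearby values live in the
    -- star of w. Its vertices lie in the finite list B, and controlling those coordinates to within
    -- the radius from `uniform` is enough.
    continuousMap : (F : X.Carrier → Pt) → (∀ v → Continuous X (λ x → coord (F x) v)) → ContinuousMap X ∣K∣
    continuousMap F cF = record
      { _⟨$⟩_      = F
      ; cong       = λ x≈y v → continuous-cong {X = X} (cF v) x≈y
      ; continuous = λ P oP → X.open-≐
          ((λ ((x , PFx) , Vy) → proj₂ (proj₂ (proj₂ (nbhd P oP x PFx))) Vy) ,
           (λ {y} PFy → (y , PFy) , proj₁ (proj₂ (proj₂ (nbhd P oP y PFy)))))
          (X.open-⋃ (∃[ x ] P (F x)) (λ (x , PFx) → proj₁ (proj₂ (nbhd P oP x PFx))))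
      }
      where
      nbhd : ∀ P → Space.IsOpen ∣K∣ P → ∀ x → P (F x) →
             Σ (Pred X.Carrier 0ℓ) λ V → X.IsOpen V × V x × (∀ {y} → V y → P (F y))
      nbhd P oP x PFx with support-nonempty (F x)
      ... | w , Fxw≉0 with locallyFinite w
      ... | B , star⊆B with uniform oP (F x) PFx (w ∷ []) B (λ ())
      ... | ε , 0<ε , ball with half 0<ε
      ... | h , 0<h , 2h≈ε =
        let V , oV , Vx , grow = support-lower-semicontinuous F cF x
            W , oW , Wx , close = continuous-list {X = X} (λ v x → coord (F x) v) (w ∷ B) cF x 0<h
        in V ∩ W , X.open-∩ oV oW , (Vx , Wx) , λ {y} (Vy , Wy) →
           let w∈ = support⊆carrier (F y) (grow Vy w Fxw≉0) in
           ball (F y) (λ { (here ≡.refl) → w∈ })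
             (λ v Fyv≉0 → inj₂ (star⊆B (isSimplex (F y)) w∈ (support⊆carrier (F y) Fyv≉0)))
             (grow Vy)
             (λ v v∈ → Close⇒Near 0<h 2h≈ε (close Wy v (merge v∈)))
        where
        merge : ∀ {v} → v ∈ w ∷ [] ⊎ v ∈ B → v ∈ w ∷ B
        merge (inj₁ (here e)) = here e
        merge (inj₂ v∈B)      = there v∈B

  -- Maps into the realization in the form in which they are constructed; `fromMap` and `toMap`
  -- translate.
  record Family {o} (X : Space o) : Set (lsuc 0ℓ ⊔ o) where
    constructor family
    field
      at         : Space.Carrier X → Pt
      continuous : ∀ v → Continuous X (λ x → coord (at x) v)

  open Family public

  fromMap : ∀ {o} {X : Space o} → ContinuousMap X ∣K∣ → Family X
  fromMap {X = X} φ = family (φ ⟨$⟩_) (λ v → continuous-∘ {X = X} {Y = ∣K∣} φ (continuous-coord v))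

  toMap : ∀ {o} {X : Space o} → Family X → ContinuousMap X ∣K∣
  toMap {X = X} F = continuousMap X (at F) (continuous F)

  constantFamily : ∀ {o} (X : Space o) → Pt → Family X
  constantFamily X p = family (λ _ → p) (λ v → continuous-const {X = X} (coord p v))

  Share : Pt → Pt → Set
  Share p q = ∃[ σ ] IsSimplex σ × In σ p × In σ q

  module _ {o} {X : Space o} (n : ℕ) (1≤n : 1 ℕ.≤ n) (u : Space.Carrier X → Carrier)
    (cu : Continuous X u) (0≤u : ∀ x → 0# ≤ u x) (u≤n : ∀ x → u x ≤ fromℕ n)
    (node : ℕ → Family X)
    (share : ∀ i → i ℕ.< n → ∀ x → Share (at (node i) x) (at (node (suc i)) x)) where

    private
      coords : Space.Carrier X → Vertex → Carrier
      coords x v = broken (λ i → coord (at (node i) x) v) n (u x)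

      on-segment : ∀ {σ} x j → j ℕ.< n → fromℕ j ≤ u x → u x ≤ fromℕ (suc j) →
                   In σ (at (node j) x) → In σ (at (node (suc j)) x) → OnSegment σ (coords x)
      on-segment x j j<n j≤u u≤1+j p q = record
        { start     = at (node j) x
        ; end       = at (node (suc j)) x
        ; start∈σ   = p
        ; end∈σ     = q
        ; ratio     = clamp (u x - fromℕ j)
        ; ratio∈    = clamp-unit _
        ; onSegment = λ v → broken-segment (λ i → coord (at (node i) x) v) n j j<n j≤u u≤1+j
        }

      point : Space.Carrier X → Pt
      point x =
        let j , j<n , j≤u , u≤1+j = segment-index n 1≤n (0≤u x) (u≤n x)
            σ , σ∈K , p , q = share j j<n x
        in segmentPoint (coords x) σ∈K (on-segment x j j<n j≤u u≤1+j p q)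

    -- Continuity concerns only the formula `coords`. The index and the simplex chosen in `point`
    -- jump with x, but they affect only the carrier and the proofs, which equality in the
    -- realization ignores.
    brokenFamily : Family X
    brokenFamily = family point λ v →
      continuous-broken {X = X} {u} (λ i x → coord (at (node i) x) v) n
        (λ i x → coord-unit (at (node i) x) v) (λ i → continuous (node i) v) cu

    in-brokenFamily : ∀ {σ} x j → j ℕ.< n → fromℕ j ≤ u x → u x ≤ fromℕ (suc j) →
                      In σ (at (node j) x) → In σ (at (node (suc j)) x) → In σ (at brokenFamily x)
    in-brokenFamily x j j<n j≤u u≤1+j p q = onSegment-zero (on-segment x j j<n j≤u u≤1+j p q)

-- Paths and chains of homotopies

module Arcs (em : ExcludedMiddle 0ℓ) (ℝ : CompleteOrderedField)
  (K : SimplicialComplex) (locallyFinite : LocallyFinite K) where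
  open CompleteOrderedField ℝ hiding (zero)
  open OrderLemmas ℝ
  open FieldArithmetic em ℝ
  open RealValued em ℝ
  open IntegerCoefficients commutativeRing
  open SimplicialComplex K
  open RealizationPoint
  open LocallyFiniteRealization em ℝ K locallyFinite

  I : Space 0ℓ
  I = UnitInterval ℝ

  record Arc (x y : Pt) : Set₁ where
    constructor arc
    field
      curve  : Family I
      source : ∀ v → coord (at curve (0ᴵ ℝ)) v ≈ coord x v
      target : ∀ v → coord (at curve (1ᴵ ℝ)) v ≈ coord y v

  open Arc

  fromPath : ∀ {x y} → Path ℝ ∣K∣ x y → Arc x y
  fromPath γ = arc (fromMap (Path.map γ)) (Path.source γ) (Path.target γ)

  toPath : ∀ {x y} → Arc x y → Path ℝ ∣K∣ x y
  toPath a = record { map = toMap (curve a) ; source = source a ; target = target a }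

  infix 4 _∼_

  -- Not transitive in general, hence the chains `Star _∼_` below.
  record _∼_ {x y : Pt} (a b : Arc x y) : Set where
    constructor sharing
    field
      shared : ∀ t → Share (at (curve a) t) (at (curve b) t)

  open _∼_

  scaled : ∀ n (t : UnitIntervalPoint ℝ) → 0# ≤ fromℕ n * value t × fromℕ n * value t ≤ fromℕ n
  scaled n t = *-nonNeg (0≤fromℕ n) (0≤value t) ,
               ≤-respʳ (*-identityʳ _) (*-monoʳ-≤ (0≤fromℕ n) (value≤1 t))

  private
    prepend : ∀ {A : Set₁} → A → (ℕ → A) → ℕ → A
    prepend a G zero    = a
    prepend a G (suc i) = G i

    -- Broken lines take nodes indexed by numbers. The first link is given separately so that there
    -- is at least one segment, as `brokenFamily` demands.
    sequence : ∀ {x y} {a b c : Arc x y} → a ∼ b → Star _∼_ b c →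
               ∃[ m ] Σ (ℕ → Arc x y) λ G → G 0 ≡ a × G (suc m) ≡ c × (∀ i → i ℕ.< suc m → G i ∼ G (suc i))
    sequence {a = a} {b} r Star.ε = 0 , prepend a (λ _ → b) , ≡.refl , ≡.refl , λ { zero _ → r ; (suc _) (ℕ.s≤s ()) }
    sequence {a = a} r (r′ ◅ rs) with sequence r′ rs
    ... | m , G , ≡.refl , end , steps = suc m , prepend a G , ≡.refl , end ,
          λ { zero _ → r ; (suc i) (ℕ.s≤s p) → steps i p }

  -- The deformation is itself a broken line, whose nodes are the given arcs.
  homotopy : ∀ {x y} (γ δ : Path ℝ ∣K∣ x y) {a} → fromPath γ ∼ a → Star _∼_ a (fromPath δ) →
             PathHomotopy ℝ ∣K∣ γ δ
  homotopy {x} {y} γ δ r rs with sequence r rs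
  ... | m , G , start , end , steps = record
        { map    = toMap H
        ; bottom = λ t v → trans (broken-≤0 _ (suc m) (≤-reflexive (zeroʳ _)))
                     (reflexive (≡.cong (λ a → coord (at (curve a) t) v) start))
        ; top    = λ t v → trans (broken-≥ _ (suc m) (≤-reflexive (sym (*-identityʳ _))))
                     (reflexive (≡.cong (λ a → coord (at (curve a) t) v) end))
        ; source = λ s v → broken-const _ (suc m) (λ i → source (G i) v)
        ; target = λ s v → broken-const _ (suc m) (λ i → target (G i) v)
        }
        where
        H : Family (I ×ₛ I)
        H = brokenFamily {X = I ×ₛ I} (suc m) (ℕ.s≤s ℕ.z≤n)
          (λ (s , _) → fromℕ (suc m) * value s)
          (continuous-proj₁ {X = I} {Y = I} (continuous-fromℕ* {X = I} (suc m) continuous-value))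
          (λ (s , _) → proj₁ (scaled (suc m) s)) (λ (s , _) → proj₂ (scaled (suc m) s))
          (λ i → family (λ (_ , t) → at (curve (G i)) t)
                        (λ v → continuous-proj₂ {X = I} {Y = I} (continuous (curve (G i)) v)))
          (λ i i<m (_ , t) → shared (steps i i<m) t)

  -- Edge paths between arbitrary points of the realization

  vertexPoint : Vertex → Pt
  vertexPoint w = record
    { coord     = indicator
    ; carrier   = w ∷ []
    ; isSimplex = vertex w
    ; unique    = [] ∷ []
    ; supported = λ v v∉ → off v (λ v≡w → v∉ (here v≡w))
    ; 0≤coord   = nonneg
    ; sum≈1     = trans (+-identityʳ _) on
    }
    where
    indicator : Vertex → Carrier
    indicator v with em {v ≡ w}
    ... | yes _ = 1#
    ... | no  _ = 0#
    off : ∀ v → v ≢ w → indicator v ≈ 0#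
    off v v≢w with em {v ≡ w}
    ... | yes v≡w = ⊥-elim (v≢w v≡w)
    ... | no  _   = refl
    nonneg : ∀ v → 0# ≤ indicator v
    nonneg v with em {v ≡ w}
    ... | yes _ = 0≤1
    ... | no  _ = ≤.refl
    on : indicator w ≈ 1#
    on with em {w ≡ w}
    ... | yes _   = refl
    ... | no  w≢w = ⊥-elim (w≢w ≡.refl)

  in-vertexPoint : ∀ {σ w} → w ∈ σ → In σ (vertexPoint w)
  in-vertexPoint {σ} {w} w∈σ v v∉σ = supported (vertexPoint w) v (λ { (here ≡.refl) → v∉σ w∈σ })

  module _ (x y : Pt) (N : ℕ) (2≤N : 2 ℕ.≤ N) where

    private
      1≤N : 1 ℕ.≤ N
      1≤N = ℕ.≤-trans (ℕ.s≤s ℕ.z≤n) 2≤N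

    -- The sequence x, f 1, ... , f (N - 1), y, y, ... : the end points replace f 0 and f N, so they
    -- may lie in the interior of simplices.
    node : (ℕ → Vertex) → ℕ → Pt
    node f zero    = x
    node f (suc j) with suc j ℕ.<? N
    ... | yes _ = vertexPoint (f (suc j))
    ... | no  _ = y

    in-node : ∀ {σ} f j → (j ≡ 0 → In σ x) → (N ℕ.≤ j → In σ y) →
              (1 ℕ.≤ j → j ℕ.< N → f j ∈ σ) → In σ (node f j)
    in-node f zero    x∈ _  _  = x∈ ≡.refl
    in-node f (suc j) _  y∈ f∈ with suc j ℕ.<? N
    ... | yes j<N = in-vertexPoint (f∈ (ℕ.s≤s ℕ.z≤n) j<N)
    ... | no  j≮N = y∈ (ℕ.≮⇒≥ j≮N)

    Ends : (ℕ → Vertex) → Set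
    Ends f = f 1 ∈ carrier x × f (ℕ.pred N) ∈ carrier y

    square : (f g : ℕ → Vertex) → ℕ → List Vertex
    square f g j = f j ∷ f (suc j) ∷ g j ∷ g (suc j) ∷ []

    -- Contiguity of simplicial maps, specialised to edge paths.
    Contiguous : (f g : ℕ → Vertex) → Set
    Contiguous f g = ∀ j → suc j ℕ.< N → IsSimplex (square f g j)

    -- The first segments of both paths lie in the carrier of x and the last ones in the carrier of
    -- y, by `Ends`; every other pair lies in its square.
    contiguous-simplex : ∀ {f g} → Ends f → Ends g → Contiguous f g → ∀ j → j ℕ.< N →
      ∃[ σ ] IsSimplex σ × (In σ (node f j) × In σ (node f (suc j))) × In σ (node g j) × In σ (node g (suc j))
    contiguous-simplex {f} {g} (f1 , _) (g1 , _) fg zero _ =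
      carrier x , isSimplex x , (first f , second f f1) , first g , second g g1
      where
      first : ∀ h → In (carrier x) (node h 0)
      first h = supported x
      second : ∀ h → h 1 ∈ carrier x → In (carrier x) (node h 1)
      second h h1 = in-node h 1 (λ ()) (λ N≤1 → ⊥-elim (ℕ.<⇒≱ 2≤N N≤1)) (λ _ _ → h1)
    contiguous-simplex {f} {g} (_ , fN) (_ , gN) fg (suc i) i<N with ℕ.m≤n⇒m<n∨m≡n i<N
    ... | inj₁ q = square f g (suc i) , fg (suc i) q ,
          (inner f i i<N (here ≡.refl) , inner f _ q (there (here ≡.refl))) ,
          inner g i i<N (there (there (here ≡.refl))) , inner g _ q (there (there (there (here ≡.refl))))
      where
      inner : ∀ h j → suc j ℕ.< N → h (suc j) ∈ square f g (suc i) → In (square f g (suc i)) (node h (suc j))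
      inner h j j<N h∈ = in-node h (suc j) (λ ()) (λ N≤j → ⊥-elim (ℕ.<⇒≱ j<N N≤j)) (λ _ _ → h∈)
    ... | inj₂ N≡ = carrier y , isSimplex y , (last-but-one f fN , last f) , last-but-one g gN , last g
      where
      last-but-one : ∀ h → h (ℕ.pred N) ∈ carrier y → In (carrier y) (node h (suc i))
      last-but-one h hN = in-node h (suc i) (λ ()) (λ N≤ → ⊥-elim (ℕ.<⇒≱ i<N N≤))
        (λ _ _ → ≡.subst (λ k → h (ℕ.pred k) ∈ carrier y) (≡.sym N≡) hN)
      last : ∀ h → In (carrier y) (node h (suc (suc i)))
      last h = in-node h (suc (suc i)) (λ ()) (λ _ → supported y) (λ _ N> → ⊥-elim (ℕ.<-irrefl N≡ N>))

    -- Repetitions in a list being harmless, `Contiguous f f` says that consecutive vertices span a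
    -- simplex.
    Thread : (ℕ → Vertex) → Set
    Thread f = Ends f × Contiguous f f

    private
      share : ∀ f → Thread f → ∀ i → i ℕ.< N → ∀ (t : UnitIntervalPoint ℝ) → Share (node f i) (node f (suc i))
      share f (ends , steps) i i<N _ =
        let σ , σ∈K , (p , q) , _ = contiguous-simplex ends ends steps i i<N in σ , σ∈K , p , q

      speed : Continuous I (λ t → fromℕ N * value t)
      speed = continuous-fromℕ* {X = I} N continuous-value

      node-last : ∀ f j v → N ℕ.≤ j → 1 ℕ.≤ j → coord (node f j) v ≈ coord y v
      node-last f (suc j) v N≤j _ with suc j ℕ.<? N
      ... | yes j<N = ⊥-elim (ℕ.<⇒≱ j<N N≤j)
      ... | no  _   = refl

    thread : ∀ f → Thread f → Arc x y
    thread f th = arc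
      (brokenFamily {X = I} N 1≤N (λ t → fromℕ N * value t) speed
        (λ t → proj₁ (scaled N t)) (λ t → proj₂ (scaled N t)) (λ i → constantFamily I (node f i)) (share f th))
      (λ v → broken-≤0 _ N (≤-reflexive (zeroʳ _)))
      (λ v → trans (broken-≥ _ N (≤-reflexive (sym (*-identityʳ _)))) (node-last f N v ℕ.≤-refl 1≤N))

    in-thread : ∀ {σ} f (th : Thread f) t j → j ℕ.< N → fromℕ j ≤ fromℕ N * value t →
                fromℕ N * value t ≤ fromℕ (suc j) → In σ (node f j) → In σ (node f (suc j)) →
                In σ (at (curve (thread f th)) t)
    in-thread f th = in-brokenFamily {X = I} N 1≤N (λ t → fromℕ N * value t) speed
      (λ t → proj₁ (scaled N t)) (λ t → proj₂ (scaled N t)) (λ i → constantFamily I (node f i)) (share f th)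

    -- Both threads run at speed N, so at any time they are on segments with the same index.
    contiguous⇒∼ : ∀ {f g} (tf : Thread f) (tg : Thread g) → Contiguous f g → thread f tf ∼ thread g tg
    contiguous⇒∼ {f} {g} tf tg fg = sharing λ t →
      let j , j<N , p , q = segment-index N 1≤N (proj₁ (scaled N t)) (proj₂ (scaled N t))
          σ , σ∈K , (a , b) , c , d = contiguous-simplex (proj₁ tf) (proj₁ tg) fg j j<N
      in σ , σ∈K , in-thread f tf t j j<N p q a b , in-thread g tg t j j<N p q c d

    ∼thread : ∀ {f} (tf : Thread f) (a : Arc x y) →
              (∀ t → ∃[ σ ] IsSimplex σ × In σ (at (curve a) t) ×
                (∀ j → j ℕ.< N → fromℕ j ≤ fromℕ N * value t → fromℕ N * value t ≤ fromℕ (suc j) →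
                 In σ (node f j) × In σ (node f (suc j)))) →
              a ∼ thread f tf
    ∼thread {f} tf a h = sharing λ t →
      let j , j<N , p , q = segment-index N 1≤N (proj₁ (scaled N t)) (proj₂ (scaled N t))
          σ , σ∈K , at∈ , nodes∈ = h t
          c , d = nodes∈ j j<N p q
      in σ , σ∈K , at∈ , in-thread f tf t j j<N p q c d

  ∼-sym : ∀ {x y} {a b : Arc x y} → a ∼ b → b ∼ a
  ∼-sym r = sharing λ t → let σ , σ∈K , p , q = shared r t in σ , σ∈K , q , p

-- Subdividing a loop

module Subdivision (em : ExcludedMiddle 0ℓ) (ℝ : CompleteOrderedField)
  (K : SimplicialComplex) (locallyFinite : LocallyFinite K) where
  open CompleteOrderedField ℝ hiding (zero)
  open OrderLemmas ℝ
  open FieldArithmetic em ℝ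
  open RealValued em ℝ
  open IntegerCoefficients commutativeRing
  open SimplicialComplex K
  open RealizationPoint
  open LocallyFiniteRealization em ℝ K locallyFinite
  open Arcs em ℝ K locallyFinite
  open Arc

  abstract
    Near-trans : ∀ {δ ε a b c} → Near δ a b → Near ε b c → Near (δ + ε) a c
    Near-trans {δ} {ε} (p , q) (p′ , q′) = add p p′ ,
        let r , s = add q′ q in ≤-respʳ (+-congˡ (+-comm ε δ)) r , λ e → s (trans e (+-congˡ (+-comm δ ε)))
      where
      add : ∀ {a b c δ ε} → a < b + δ → b < c + ε → a < c + (δ + ε)
      add {a} {b} {c} {δ} {ε} p q = ≰⇒> λ r → <⇒≱ p (≤-by (0≤-+ (≤⇒0≤- (proj₁ q)) (≤⇒0≤- r))
        (solve 5 (λ a b c δ ε → b :+ δ :+ ((c :+ ε :- b) :+ (a :- (c :+ (δ :+ ε)))) := a) refl a b c δ ε))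

    Near-respˡ : ∀ {ε a a′ b} → a ≈ a′ → Near ε a b → Near ε a′ b
    Near-respˡ a≈ ((p , p′) , (q , q′)) =
      (≤-respˡ a≈ p , λ e → p′ (trans a≈ e)) , (≤-respʳ (+-congʳ a≈) q , λ e → q′ (trans e (+-congʳ (sym a≈))))

    Near-resp-radius : ∀ {ε ε′ a b} → ε ≈ ε′ → Near ε a b → Near ε′ a b
    Near-resp-radius ε≈ = Near-mono (≤-reflexive ε≈)

  module _ (γ : Family I) where

    _⊑_ : Pt → Pt → Set
    p ⊑ q = ∀ v → ¬ (coord p v ≈ 0#) → ¬ (coord q v ≈ 0#)

    abstract
      support-near : ∀ s → ∃[ ε ] 0# < ε × (∀ t → Near ε (value s) (value t) → at γ s ⊑ at γ t)
      support-near s =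
        let V , oV , Vs , grow = support-lower-semicontinuous I (at γ) (continuous γ) s
            ε , 0<ε , ball = oV s Vs
        in ε , 0<ε , λ t near → grow (ball t near)

    -- The δ-ball about t is mapped into the open star of a single vertex.
    StarBall : Carrier → UnitIntervalPoint ℝ → Set
    StarBall δ t = ∃[ v ] (∀ t′ → Near δ (value t) (value t′) → ¬ (coord (at γ t′) v ≈ 0#))

    private
      StarBall-mono : ∀ {δ ε t} → δ ≤ ε → StarBall ε t → StarBall δ t
      StarBall-mono δ≤ε (v , ball) = v , λ t′ near → ball t′ (Near-mono δ≤ε near)

      Good : Carrier → Set
      Good c = c ≤ 1# × ∃[ δ ] 0# < δ × (∀ t → value t ≤ c → StarBall δ t)

      good-0 : Good 0#
      good-0 =
        let ε , 0<ε , grow = support-near (0ᴵ ℝ)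
            w , w≉0 = support-nonempty (at γ (0ᴵ ℝ))
        in 0≤1 , ε , 0<ε , λ t t≤0 →
           w , λ t′ near → grow t′ (Near-respˡ (≤.antisym t≤0 (0≤value t)) near) w w≉0

    -- A Lebesgue number for the cover by open stars, with compactness replaced by a supremum: if s
    -- is the supremum of the c up to which one radius works, then a radius for some c just below s,
    -- combined with a star containing the path near s, works up to s + d. Hence s + d reaches 1.
    lebesgue-number : ∃[ δ ] 0# < δ × (∀ t → StarBall δ t)
    lebesgue-number with supremum Good (0# , good-0) (1# , λ c (c≤1 , _) → c≤1)
    ... | s , upper , least
      with support-near (mkPoint s (upper 0# good-0) (least 1# (λ c (c≤1 , _) → c≤1)))
         | support-nonempty (at γ (mkPoint s (upper 0# good-0) (least 1# (λ c (c≤1 , _) → c≤1))))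
    ... | ε , 0<ε , grow | w , w≉0 with half 0<ε
    ... | η , 0<η , 2η≈ε with half 0<η | em {∃[ c ] Good c × s - η < c}
    ... | d , 0<d , 2d≈η | no none = ⊥-elim (<⇒≱ (x<x+ε s 0<η) (≤-by (≤⇒0≤- (least (s - η) bound))
          (solve 2 (λ s δ → s :+ δ :+ ((s :- δ) :- s) := s) refl s η)))
      where
      bound : UpperBound Good (s - η)
      bound c good with ≤-or-> c (s - η)
      ... | inj₁ c≤ = c≤
      ... | inj₂ <c = ⊥-elim (none (c , good , <c))
    ... | d , 0<d , 2d≈η | yes (c , (_ , δ , 0<δ , below-c) , s-η<c) with minimum 0<δ 0<η
    ... | θ , 0<θ , θ≤δ , θ≤η = finish (≤.total (s + d) 1#)
      where
      ball : ∀ t → value t ≤ s + d → StarBall θ t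
      ball t t≤s+d with ≤-or-> (value t) c
      ... | inj₁ t≤c = StarBall-mono {t = t} θ≤δ (below-c t t≤c)
      -- Here t lies within η = ε / 2 of s, and θ is at most η, so the θ-ball about t stays in the
      -- ε-ball about s.
      ... | inj₂ c<t = w , λ t′ near → grow t′ (Near-resp-radius 2η≈ε
            (Near-trans (s<t+η , t<s+η) (Near-mono θ≤η near))) w w≉0
        where
        s<t+η : s < value t + η
        s<t+η = ≰⇒> λ r → <⇒≱ c<t (≤.trans (≤-by (≤⇒0≤- r)
          (solve 3 (λ t s η → t :+ (s :- (t :+ η)) := s :- η) refl (value t) s η)) (proj₁ s-η<c))
        t<s+η : value t < s + η
        t<s+η = ≤-<-trans t≤s+d (let p , q = x<x+ε d 0<d in
          +-monoʳ-< s (≤-respʳ 2d≈η p , λ e → q (trans e (sym 2d≈η))))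
      finish : s + d ≤ 1# ⊎ 1# ≤ s + d → ∃[ δ ] 0# < δ × (∀ t → StarBall δ t)
      finish (inj₁ s+d≤1) = ⊥-elim (<⇒≱ (x<x+ε s 0<d) (upper (s + d) (s+d≤1 , θ , 0<θ , ball)))
      finish (inj₂ 1≤s+d) = θ , 0<θ , λ t → ball t (≤.trans (value≤1 t) 1≤s+d)

    abstract
      lebesgue : ∃[ δ ] 0# < δ × (∀ t → StarBall δ t)
      lebesgue = lebesgue-number

  -- One tick is at most a third of δ, so times at most two ticks apart are strictly within δ. Two
  -- ticks occur because label 1 is forced to be w and must cover the times up to tick 2; the other
  -- end is symmetric.
  3# : Carrier
  3# = 2# + 1#

  module _ {x : Pt} (γ : Arc x x) (w : Vertex) (xw≉0 : ¬ (coord x w ≈ 0#)) where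

    private
      path : UnitIntervalPoint ℝ → Pt
      path = at (curve γ)

    -- Tick i stands for time i / `size`. By `covers`, both labels of a tick interval are in the
    -- support throughout that interval. The first two labels and all from `size` - 1 on are w, so
    -- the first and last edges are constant and their refinements begin and end at w. Through
    -- `near-0` and `near-1` the node x shares a simplex with the path during the first and last
    -- interval.
    record Grid : Set where
      field
        size      : ℕ
        2≤size    : 2 ℕ.≤ size
        label     : ℕ → Vertex
        covers    : ∀ i t → i ℕ.≤ size → fromℕ i ≤ fromℕ size * value t + 1# →
                    fromℕ size * value t ≤ fromℕ i + 1# → ¬ (coord (path t) (label i) ≈ 0#)
        first     : ∀ i → i ℕ.≤ 1 → label i ≡ w
        last      : ∀ i → size ℕ.≤ suc i → label i ≡ w
        adjacent  : ∀ i → IsSimplex (label i ∷ label (suc i) ∷ [])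
        near-0    : ∀ t → fromℕ size * value t ≤ 1# → ∀ v → ¬ (coord x v ≈ 0#) → ¬ (coord (path t) v ≈ 0#)
        near-1    : ∀ t → fromℕ size ≤ fromℕ size * value t + 1# →
                    ∀ v → ¬ (coord x v ≈ 0#) → ¬ (coord (path t) v ≈ 0#)

    grid : Grid
    grid with lebesgue (curve γ) | support-near (curve γ) (0ᴵ ℝ) | support-near (curve γ) (1ᴵ ℝ)
    ... | δ₀ , 0<δ₀ , star | ε₀ , 0<ε₀ , grow₀ | ε₁ , 0<ε₁ , grow₁ with minimum 0<ε₀ 0<ε₁
    ... | ε , 0<ε , ε≤ε₀ , ε≤ε₁ with minimum 0<δ₀ 0<ε
    ... | δ , 0<δ , δ≤δ₀ , δ≤ε with archimedean 0<δ 3#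
    ... | M , 3≤Mδ = record
      { size     = N
      ; 2≤size   = ℕ.s≤s (ℕ.s≤s ℕ.z≤n)
      ; label    = λ i → proj₁ (label i)
      ; covers   = λ i → proj₂ (proj₂ (proj₂ (label i)))
      ; first    = λ i → proj₁ (proj₂ (label i))
      ; last     = λ i → proj₁ (proj₂ (proj₂ (label i)))
      ; adjacent = adjacent
      ; near-0   = λ t p → near-0 t (≤.trans p (≤-respˡ (+-identityʳ 1#) (+-monoʳ-≤ 1# 0≤1)))
      ; near-1   = λ t p → near-1 t (≤.trans p (+-monoʳ-≤ _ (≤-respˡ (+-identityʳ 1#) (+-monoʳ-≤ 1# 0≤1))))
      }
      where
      N : ℕ
      N = 2 ℕ.+ M
      0<N : 0# < fromℕ N
      0<N = 0<fromℕ {N} (ℕ.s≤s ℕ.z≤n)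
      3≤Nδ : 3# ≤ fromℕ N * δ
      3≤Nδ = ≤.trans 3≤Mδ (≤-respˡ (*-comm _ _) (≤-respʳ (*-comm _ _)
        (*-monoʳ-≤ (proj₁ 0<δ) (fromℕ-mono (ℕ.m≤n+m M 2)))))
      near : ∀ {s t} → fromℕ N * s ≤ fromℕ N * t + 2# → fromℕ N * t ≤ fromℕ N * s + 2# → Near δ s t
      near p q = side p , side q
        where
        side : ∀ {s t} → fromℕ N * s ≤ fromℕ N * t + 2# → s < t + δ
        side {s} {t} p = ≰⇒> λ r → <⇒≱ 0<1 (≤-by
          (0≤-+ (0≤-+ (≤⇒0≤- p) (≤⇒0≤- 3≤Nδ)) (≤⇒0≤- (*-monoʳ-≤ (proj₁ 0<N) r)))
          (solve 4 (λ N s t δ → con (+ 1) :+ (((N :* t :+ con (+ 2) :- N :* s) :+ (N :* δ :- con (+ 3)))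
              :+ (N :* s :- N :* (t :+ δ))) := con (+ 0)) refl (fromℕ N) s t δ))
      near-0 : ∀ t → fromℕ N * value t ≤ 2# → ∀ v → ¬ (coord x v ≈ 0#) → ¬ (coord (path t) v ≈ 0#)
      near-0 t p v xv≉0 = grow₀ t (Near-mono (≤.trans δ≤ε ε≤ε₀) (near
          (≤.trans (≤-reflexive (zeroʳ _)) (0≤-+ (*-nonNeg (proj₁ 0<N) (0≤value t)) 0≤2))
          (≤-respʳ (sym (trans (+-congʳ (zeroʳ _)) (+-identityˡ 2#))) p)))
        v (λ e → xv≉0 (trans (sym (source γ v)) e))
      near-1 : ∀ t → fromℕ N ≤ fromℕ N * value t + 2# → ∀ v → ¬ (coord x v ≈ 0#) → ¬ (coord (path t) v ≈ 0#)
      near-1 t p v xv≉0 = grow₁ t (Near-mono (≤.trans δ≤ε ε≤ε₁) (near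
          (≤-respˡ (sym (*-identityʳ _)) p)
          (≤.trans (*-monoʳ-≤ (proj₁ 0<N) (value≤1 t)) (≤-respˡ (+-identityʳ _) (+-monoʳ-≤ _ 0≤2)))))
        v (λ e → xv≉0 (trans (sym (target γ v)) e))
      tick : ∀ i → i ℕ.≤ N → ∃[ t ] fromℕ N * value t ≈ fromℕ i
      tick i i≤N with inverse-pos 0<N
      ... | y , 0≤y , Ny≈1 = mkPoint (y * fromℕ i) (*-nonNeg 0≤y (0≤fromℕ i))
            (≤.trans (*-monoʳ-≤ 0≤y (fromℕ-mono i≤N)) (≤-reflexive (trans (*-comm _ _) Ny≈1))) ,
            trans (sym (*-assoc _ _ _)) (trans (*-congʳ Ny≈1) (*-identityˡ _))
      label : ∀ i → ∃[ v ] (i ℕ.≤ 1 → v ≡ w) × (N ℕ.≤ suc i → v ≡ w) ×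
              (∀ t → i ℕ.≤ N → fromℕ i ≤ fromℕ N * value t + 1# →
                fromℕ N * value t ≤ fromℕ i + 1# → ¬ (coord (path t) v ≈ 0#))
      label i with i ℕ.≤? 1 | N ℕ.≤? suc i
      ... | yes i≤1 | _ = w , (λ _ → ≡.refl) , (λ _ → ≡.refl) , λ t _ _ q →
            near-0 t (≤.trans q (+-monoˡ-≤ 1# (≤-respʳ (+-identityʳ 1#) (fromℕ-mono i≤1)))) w xw≉0
      ... | no _ | yes N≤1+i = w , (λ _ → ≡.refl) , (λ _ → ≡.refl) , λ t _ p _ →
            near-1 t (≤.trans (fromℕ-mono N≤1+i) (≤.trans (≤-reflexive (fromℕ-suc i))
              (≤.trans (+-monoˡ-≤ 1# p) (≤-reflexive (+-assoc _ _ _))))) w xw≉0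
      ... | no i≰1 | no N≰1+i =
            let t₀ , Nt₀≈i = tick i (ℕ.≤-trans (ℕ.n≤1+n i) (ℕ.<⇒≤ (ℕ.≰⇒> N≰1+i)))
                v , ball = star t₀
            in v , (λ p → ⊥-elim (i≰1 p)) , (λ p → ⊥-elim (N≰1+i p)) , λ t _ p q →
               ball t (Near-mono δ≤δ₀ (near
                 (≤.trans (≤-reflexive Nt₀≈i) (≤.trans p (+-monoʳ-≤ _ 1≤2)))
                 (≤.trans q (≤.trans (+-monoʳ-≤ _ 1≤2) (≤-reflexive (+-congʳ (sym Nt₀≈i)))))))
        where
        1≤2 : 1# ≤ 2#
        1≤2 = ≤-respˡ (+-identityʳ 1#) (+-monoʳ-≤ 1# 0≤1)
      adjacent : ∀ i → IsSimplex (proj₁ (label i) ∷ proj₁ (label (suc i)) ∷ [])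
      adjacent i with ℕ.≤-<-connex N i
      ... | inj₁ N≤i = face (vertex w) (λ { (here e) → here (≡.trans e (both i (ℕ.m≤n⇒m≤1+n N≤i)))
                                          ; (there (here e)) → here (≡.trans e (both (suc i) (ℕ.m≤n⇒m≤1+n (ℕ.m≤n⇒m≤1+n N≤i)))) }) (λ ())
        where
        both : ∀ i → N ℕ.≤ suc i → proj₁ (label i) ≡ w
        both i = proj₁ (proj₂ (proj₂ (label i)))
      -- At tick i both labels are in the support, since i and i + 1 are within one tick of it.
      ... | inj₂ i<N = face (isSimplex (path t))
            (λ { (here ≡.refl) → support⊆carrier (path t) (proj₂ (proj₂ (proj₂ (label i))) t (ℕ.<⇒≤ i<N)
                   (≤.trans (≤-reflexive (sym Nt≈i)) (≤-respˡ (+-identityʳ _) (+-monoʳ-≤ _ 0≤1)))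
                   (≤.trans (≤-reflexive Nt≈i) (≤-respˡ (+-identityʳ _) (+-monoʳ-≤ _ 0≤1))))
               ; (there (here ≡.refl)) → support⊆carrier (path t) (proj₂ (proj₂ (proj₂ (label (suc i)))) t i<N
                   (≤-reflexive (trans (fromℕ-suc i) (+-congʳ (sym Nt≈i))))
                   (≤.trans (≤-reflexive Nt≈i) (≤.trans (proj₁ (n<1+n i)) (≤-respˡ (+-identityʳ _) (+-monoʳ-≤ _ 0≤1))))) })
            (λ ())
        where
        t : UnitIntervalPoint ℝ
        t = proj₁ (tick i (ℕ.<⇒≤ i<N))
        Nt≈i : fromℕ N * value t ≈ fromℕ i
        Nt≈i = proj₂ (tick i (ℕ.<⇒≤ i<N))

-- Walks in the lattice

module LatticeWalks where
  open ℤ-Solver.+-*-Solver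

  private
    dist : ℤ → ℤ → ℕ
    dist a b = ℤ.∣ a ℤ.- b ∣

    dist-self : ∀ a → dist a a ≡ 0
    dist-self a = ≡.cong ℤ.∣_∣ (ℤ.+-inverseʳ a)

    dist-neg : ∀ a b → dist (ℤ.- a) (ℤ.- b) ≡ dist a b
    dist-neg a b = ≡.trans (≡.cong ℤ.∣_∣ (≡.sym (ℤ.neg-distrib-+ a (ℤ.- b)))) (ℤ.∣-i∣≡∣i∣ (a ℤ.- b))

    dist-triangle : ∀ a b c → dist a c ℕ.≤ dist a b ℕ.+ dist b c
    dist-triangle a b c = ≡.subst (λ z → ℤ.∣ z ∣ ℕ.≤ dist a b ℕ.+ dist b c)
      (ℤ.+-minus-telescope a b c) (ℤ.∣i+j∣≤∣i∣+∣j∣ (a ℤ.- b) (b ℤ.- c))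

    dist≤0⇒≡ : ∀ a b → dist a b ℕ.≤ 0 → a ≡ b
    dist≤0⇒≡ a b p = ℤ.i-j≡0⇒i≡j a b (ℤ.∣i∣≡0⇒i≡0 (ℕ.n≤0⇒n≡0 p))

    shrink : ℤ → ℤ
    shrink (+ m)    = + ℕ.pred m
    shrink -[1+ m ] = ℤ.- (+ m)

    ∣shrink∣ : ∀ a → ℤ.∣ shrink a ∣ ≡ ℕ.pred ℤ.∣ a ∣
    ∣shrink∣ (+ m)    = ≡.refl
    ∣shrink∣ -[1+ m ] = ℤ.∣-i∣≡∣i∣ (+ m)

    shrink-lipschitz-pos : ∀ m n → dist (shrink (+ m)) (shrink (+ n)) ℕ.≤ dist (+ m) (+ n)
    shrink-lipschitz-pos zero    zero    = ℕ.≤-refl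
    shrink-lipschitz-pos zero    (suc n) = ℕ.≤-trans (ℕ.≤-reflexive (≡.trans
      (≡.cong ℤ.∣_∣ (ℤ.+-identityˡ (ℤ.- (+ n)))) (ℤ.∣-i∣≡∣i∣ (+ n)))) (ℕ.n≤1+n n)
    shrink-lipschitz-pos (suc m) zero    =
      ℕ.≤-trans (ℕ.≤-reflexive (≡.cong ℤ.∣_∣ (ℤ.+-identityʳ (+ m))))
        (ℕ.≤-trans (ℕ.n≤1+n m) (ℕ.≤-reflexive (≡.cong ℤ.∣_∣ (≡.sym (ℤ.+-identityʳ (+ suc m))))))
    shrink-lipschitz-pos (suc m) (suc n) = ℕ.≤-reflexive (≡.cong ℤ.∣_∣
      (≡.trans (ℤ.[+m]-[+n]≡m⊖n m n) (≡.sym (ℤ.[1+m]⊖[1+n]≡m⊖n m n))))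

    shrink-lipschitz-mixed : ∀ m n → dist (shrink (+ m)) (shrink -[1+ n ]) ℕ.≤ dist (+ m) -[1+ n ]
    shrink-lipschitz-mixed m n = ℕ.≤-trans
      (ℕ.≤-reflexive (≡.cong (λ z → ℤ.∣ + ℕ.pred m ℤ.+ z ∣) (ℤ.neg-involutive (+ n))))
      (ℕ.+-mono-≤ ℕ.pred[n]≤n (ℕ.n≤1+n n))

    -- For opposite signs the distance is the sum of the absolute values, and neither grows; equal
    -- signs reduce to natural numbers by negation.
    shrink-lipschitz : ∀ a b → dist (shrink a) (shrink b) ℕ.≤ dist a b
    shrink-lipschitz (+ m)    (+ n)    = shrink-lipschitz-pos m n
    shrink-lipschitz (+ m)    -[1+ n ] = shrink-lipschitz-mixed m n
    shrink-lipschitz -[1+ m ] (+ n)    = ≡.subst₂ ℕ._≤_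
      (ℤ.∣i-j∣≡∣j-i∣ (shrink (+ n)) (shrink -[1+ m ])) (ℤ.∣i-j∣≡∣j-i∣ (+ n) -[1+ m ]) (shrink-lipschitz-mixed n m)
    shrink-lipschitz -[1+ m ] -[1+ n ] = ≡.subst₂ ℕ._≤_
      (≡.sym (dist-neg (+ m) (+ n))) (≡.sym (dist-neg (+ suc m) (+ suc n))) (shrink-lipschitz-pos (suc m) (suc n))

    1+m-m : ∀ m → dist (+ suc m) (+ m) ≡ 1
    1+m-m m = ≡.cong ℤ.∣_∣ (solve 1 (λ m → (con (+ 1) :+ m) :- m := con (+ 1)) ≡.refl (+ m))

    shrink-move : ∀ a → dist a (shrink a) ℕ.≤ 1
    shrink-move (+ zero)  = ℕ.z≤n
    shrink-move (+ suc m) = ℕ.≤-reflexive (1+m-m m)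
    shrink-move -[1+ m ]  = ℕ.≤-reflexive (≡.trans (dist-neg (+ suc m) (+ m)) (1+m-m m))

    shrink-geodesic : ∀ a → dist a (shrink a) ℕ.+ ℤ.∣ shrink a ∣ ℕ.≤ ℤ.∣ a ∣
    shrink-geodesic (+ zero)  = ℕ.z≤n
    shrink-geodesic (+ suc m) = ℕ.+-monoˡ-≤ m (shrink-move (+ suc m))
    shrink-geodesic -[1+ m ]  = ℕ.+-mono-≤ (shrink-move -[1+ m ]) (ℕ.≤-reflexive (ℤ.∣-i∣≡∣i∣ (+ m)))

    towards : ℤ → ℤ → ℤ
    towards b a = b ℤ.+ shrink (a ℤ.- b)

    towards-lipschitz : ∀ b a c → dist (towards b a) (towards b c) ℕ.≤ dist a c
    towards-lipschitz b a c = ≡.subst₂ (λ p q → ℤ.∣ p ∣ ℕ.≤ ℤ.∣ q ∣)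
      (solve 3 (λ b p q → p :- q := (b :+ p) :- (b :+ q)) ≡.refl b (shrink (a ℤ.- b)) (shrink (c ℤ.- b)))
      (solve 3 (λ a b c → (a :- b) :- (c :- b) := a :- c) ≡.refl a b c)
      (shrink-lipschitz (a ℤ.- b) (c ℤ.- b))

    towards-move-≡ : ∀ b a → dist a (towards b a) ≡ dist (a ℤ.- b) (shrink (a ℤ.- b))
    towards-move-≡ b a = ≡.cong ℤ.∣_∣
      (solve 3 (λ a b s → a :- (b :+ s) := (a :- b) :- s) ≡.refl a b (shrink (a ℤ.- b)))

    towards-target-≡ : ∀ b a → dist (towards b a) b ≡ ℤ.∣ shrink (a ℤ.- b) ∣
    towards-target-≡ b a = ≡.cong ℤ.∣_∣
      (solve 2 (λ b s → (b :+ s) :- b := s) ≡.refl b (shrink (a ℤ.- b)))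

    approach : ℤ → ℕ → ℤ → ℤ
    approach b zero    a = a
    approach b (suc k) a = approach b k (towards b a)

    approach-lipschitz : ∀ b k a c → dist (approach b k a) (approach b k c) ℕ.≤ dist a c
    approach-lipschitz b zero    a c = ℕ.≤-refl
    approach-lipschitz b (suc k) a c = ℕ.≤-trans
      (approach-lipschitz b k (towards b a) (towards b c)) (towards-lipschitz b a c)

    -- The two points are the images of a and of `towards b a` under the same 1-Lipschitz map,
    -- because `approach` takes its first step innermost.
    approach-step : ∀ b k a → dist (approach b k a) (approach b (suc k) a) ℕ.≤ 1
    approach-step b k a = ℕ.≤-trans (approach-lipschitz b k a (towards b a))
      (ℕ.≤-trans (ℕ.≤-reflexive (towards-move-≡ b a)) (shrink-move (a ℤ.- b)))

    approach-target : ∀ b k a → dist (approach b k a) b ℕ.≤ dist a b ∸ k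
    approach-target b zero    a = ℕ.≤-refl
    approach-target b (suc k) a = ℕ.≤-trans (approach-target b k (towards b a)) (ℕ.≤-reflexive
      (≡.trans (≡.cong (_∸ k) (≡.trans (towards-target-≡ b a) (∣shrink∣ (a ℤ.- b)))) (pred-∸ (dist a b) k)))
      where
      pred-∸ : ∀ m k → ℕ.pred m ∸ k ≡ m ∸ suc k
      pred-∸ zero    k = ℕ.0∸n≡0 k
      pred-∸ (suc m) k = ≡.refl

    approach-arrives : ∀ b k a → dist a b ℕ.≤ k → approach b k a ≡ b
    approach-arrives b k a p = dist≤0⇒≡ _ b (ℕ.≤-trans (approach-target b k a) (ℕ.≤-reflexive (ℕ.m≤n⇒m∸n≡0 p)))

    -- Each step uses up as much of the distance to b as it moves, so the motion follows a geodesic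
    -- and never overshoots.
    approach-between : ∀ b k a → dist a (approach b k a) ℕ.≤ dist a b
    approach-between b zero    a = ℕ.≤-trans (ℕ.≤-reflexive (dist-self a)) ℕ.z≤n
    approach-between b (suc k) a = begin
      dist a (approach b k a′)                                ≤⟨ dist-triangle a a′ _ ⟩
      dist a a′ ℕ.+ dist a′ (approach b k a′)                 ≤⟨ ℕ.+-monoʳ-≤ (dist a a′) (approach-between b k a′) ⟩
      dist a a′ ℕ.+ dist a′ b                                 ≡⟨ ≡.cong₂ ℕ._+_ (towards-move-≡ b a) (towards-target-≡ b a) ⟩
      dist (a ℤ.- b) (shrink (a ℤ.- b)) ℕ.+ ℤ.∣ shrink (a ℤ.- b) ∣ ≤⟨ shrink-geodesic (a ℤ.- b) ⟩
      dist a b                                                ∎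
      where
      open ℕ.≤-Reasoning
      a′ : ℤ
      a′ = towards b a

  manhattan-self : ∀ {n} (x : Vec ℤ n) → manhattan x x ≡ 0
  manhattan-self []      = ≡.refl
  manhattan-self (a ∷ x) = ≡.cong₂ ℕ._+_ (dist-self a) (manhattan-self x)

  -- After a unit steps from x towards b: the first coordinate is moved during the first R
  -- steps, the second one during the next R steps, and so on.
  walk : ∀ {n} → Vec ℤ n → ℕ → ℕ → Vec ℤ n → Vec ℤ n
  walk []      R a []      = []
  walk (b ∷ t) R a (c ∷ x) = approach b a c ∷ walk t R (a ∸ R) x

  walk-start : ∀ {n} (b : Vec ℤ n) R x → walk b R 0 x ≡ x
  walk-start []      R []      = ≡.refl
  walk-start (b ∷ t) R (c ∷ x) =
    ≡.cong (c ∷_) (≡.trans (≡.cong (λ a → walk t R a x) (ℕ.0∸n≡0 R)) (walk-start t R x))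

  walk-lipschitz : ∀ {n} (b : Vec ℤ n) R a x y → manhattan (walk b R a x) (walk b R a y) ℕ.≤ manhattan x y
  walk-lipschitz []      R a []      []      = ℕ.z≤n
  walk-lipschitz (b ∷ t) R a (c ∷ x) (d ∷ y) =
    ℕ.+-mono-≤ (approach-lipschitz b a c d) (walk-lipschitz t R (a ∸ R) x y)

  walk-between : ∀ {n} (b : Vec ℤ n) R a x → manhattan x (walk b R a x) ℕ.≤ manhattan x b
  walk-between []      R a []      = ℕ.z≤n
  walk-between (b ∷ t) R a (c ∷ x) = ℕ.+-mono-≤ (approach-between b a c) (walk-between t R (a ∸ R) x)

  -- Only one coordinate moves at a time. While a < R, truncated subtraction keeps the later
  -- coordinates at step 0; once R ≤ a, the first one has arrived, its distance being at most R.
  walk-step : ∀ {n} (b : Vec ℤ n) R a x → manhattan x b ℕ.≤ R →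
              manhattan (walk b R a x) (walk b R (suc a) x) ℕ.≤ 1
  walk-step []      R a []      _ = ℕ.z≤n
  walk-step (b ∷ t) R a (c ∷ x) p with ℕ.≤-<-connex R a
  ... | inj₁ R≤a rewrite ℕ.+-∸-assoc 1 R≤a
                       | approach-arrives b a c (ℕ.≤-trans (ℕ.≤-trans (ℕ.m≤m+n _ _) p) R≤a)
                       | approach-arrives b (suc a) c (ℕ.m≤n⇒m≤1+n (ℕ.≤-trans (ℕ.≤-trans (ℕ.m≤m+n _ _) p) R≤a))
                       | dist-self b
      = walk-step t R (a ∸ R) x (ℕ.≤-trans (ℕ.m≤n+m _ _) p)
  ... | inj₂ a<R rewrite ℕ.m≤n⇒m∸n≡0 (ℕ.<⇒≤ a<R) | ℕ.m≤n⇒m∸n≡0 a<R | manhattan-self (walk t R 0 x)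
      = ℕ.≤-trans (ℕ.≤-reflexive (ℕ.+-identityʳ _)) (approach-step b a c)

  walk-end : ∀ {n} (b : Vec ℤ n) R a x → manhattan x b ℕ.≤ R → n ℕ.* R ℕ.≤ a → walk b R a x ≡ b
  walk-end []      R a []      _ _ = ≡.refl
  walk-end {suc n} (b ∷ t) R a (c ∷ x) p q = ≡.cong₂ _∷_
    (approach-arrives b a c (ℕ.≤-trans (ℕ.m≤m+n _ _) (ℕ.≤-trans p (ℕ.≤-trans (ℕ.m≤m+n R (n ℕ.* R)) q))))
    (walk-end t R (a ∸ R) x (ℕ.≤-trans (ℕ.m≤n+m _ _) p)
      (≡.subst (ℕ._≤ a ∸ R) (ℕ.m+n∸m≡n R (n ℕ.* R)) (ℕ.∸-monoˡ-≤ R q)))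

  walk-fix : ∀ {n} (b : Vec ℤ n) R a → walk b R a b ≡ b
  walk-fix []      R a = ≡.refl
  walk-fix (b ∷ t) R a = ≡.cong₂ _∷_
    (approach-arrives b a b (ℕ.≤-trans (ℕ.≤-reflexive (dist-self b)) ℕ.z≤n)) (walk-fix t R (a ∸ R))

  private
    interval : ℕ → List ℤ
    interval R = List.map +_ (List.upTo (suc R)) List.++ List.map (λ m → ℤ.- (+ m)) (List.upTo (suc R))

    ∈-interval : ∀ {R} a → ℤ.∣ a ∣ ℕ.≤ R → a ∈ interval R
    ∈-interval {R} (+ m)    p = ∈-++⁺ˡ (∈-map⁺ +_ (∈-upTo⁺ (ℕ.s≤s p)))
    ∈-interval {R} -[1+ m ] p =
      ∈-++⁺ʳ (List.map +_ (List.upTo (suc R))) (∈-map⁺ (λ m → ℤ.- (+ m)) (∈-upTo⁺ (ℕ.s≤s p)))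

  -- In fact a cube: a finite list that contains the metric ball.
  ball : ∀ {n} → ℕ → Vec ℤ n → List (Vec ℤ n)
  ball R []      = [] ∷ []
  ball R (c ∷ x) = List.cartesianProductWith (λ e y → (c ℤ.- e) ∷ y) (interval R) (ball R x)

  ∈-ball : ∀ {n} R (x y : Vec ℤ n) → manhattan x y ℕ.≤ R → y ∈ ball R x
  ∈-ball R []      []      _ = here ≡.refl
  ∈-ball R (c ∷ x) (d ∷ y) p = ≡.subst (λ e → (e ∷ y) ∈ ball R (c ∷ x))
    (solve 2 (λ c d → c :- (c :- d) := d) ≡.refl c d)
    (∈-cartesianProductWith⁺ (λ e y → (c ℤ.- e) ∷ y) (∈-interval (c ℤ.- d) (ℕ.≤-trans (ℕ.m≤m+n _ _) p))
      (∈-ball R x y (ℕ.≤-trans (ℕ.m≤n+m _ _) p)))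

-- The Vietoris–Rips complex of the lattice

module Blocks (k : ℕ) where

  private
    next : ℕ × ℕ → ℕ × ℕ
    next (i , l) with l ℕ.<? k
    ... | yes _ = i , suc l
    ... | no  _ = suc i , 0

  -- Quotient and remainder of j by suc k.
  index : ℕ → ℕ × ℕ
  index zero    = 0 , 0
  index (suc j) = next (index j)

  block offset : ℕ → ℕ
  block j  = proj₁ (index j)
  offset j = proj₂ (index j)

  -- The form in which the division is used: a path either continues along its current edge or turns
  -- to the next one.
  index-suc : ∀ j → index (suc j) ≡ (block j , suc (offset j)) × offset j ℕ.< k ⊎
                    index (suc j) ≡ (suc (block j) , 0) × k ℕ.≤ offset j
  index-suc j with offset j ℕ.<? k
  ... | yes l<k = inj₁ (≡.refl , l<k)
  ... | no  l≮k = inj₂ (≡.refl , ℕ.≮⇒≥ l≮k)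

  offset≤ : ∀ j → offset j ℕ.≤ k
  offset≤ zero    = ℕ.z≤n
  offset≤ (suc j) with index-suc j
  ... | inj₁ (eq , l<k) = ≡.subst (λ p → proj₂ p ℕ.≤ k) (≡.sym eq) l<k
  ... | inj₂ (eq , _)   = ≡.subst (λ p → proj₂ p ℕ.≤ k) (≡.sym eq) ℕ.z≤n

  index-spec : ∀ j → block j ℕ.* suc k ℕ.+ offset j ≡ j
  index-spec zero    = ≡.refl
  index-spec (suc j) with index-suc j
  ... | inj₁ (eq , _) = ≡.trans (≡.cong (λ (i , l) → i ℕ.* suc k ℕ.+ l) eq)
        (≡.trans (ℕ.+-suc (block j ℕ.* suc k) (offset j)) (≡.cong suc (index-spec j)))
  ... | inj₂ (eq , k≤l) = ≡.trans (≡.cong (λ (i , l) → i ℕ.* suc k ℕ.+ l) eq) (begin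
        suc (block j) ℕ.* suc k ℕ.+ 0         ≡⟨ ℕ.+-identityʳ _ ⟩
        suc k ℕ.+ block j ℕ.* suc k           ≡⟨ ℕ.+-comm (suc k) _ ⟩
        block j ℕ.* suc k ℕ.+ suc k           ≡⟨ ≡.cong (λ l → block j ℕ.* suc k ℕ.+ suc l) (ℕ.≤-antisym k≤l (offset≤ j)) ⟩
        block j ℕ.* suc k ℕ.+ suc (offset j)  ≡⟨ ℕ.+-suc _ _ ⟩
        suc (block j ℕ.* suc k ℕ.+ offset j)  ≡⟨ ≡.cong suc (index-spec j) ⟩
        suc j                                 ∎)
    where open ≡.≡-Reasoning

  block*≤ : ∀ j → block j ℕ.* suc k ℕ.≤ j
  block*≤ j = ℕ.≤-trans (ℕ.m≤m+n _ (offset j)) (ℕ.≤-reflexive (index-spec j))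

  <block* : ∀ j → suc j ℕ.≤ suc (block j) ℕ.* suc k
  <block* j = begin
    suc j                                       ≡⟨ ≡.cong suc (index-spec j) ⟨
    suc (block j ℕ.* suc k ℕ.+ offset j)        ≤⟨ ℕ.s≤s (ℕ.+-monoʳ-≤ (block j ℕ.* suc k) (offset≤ j)) ⟩
    suc (block j ℕ.* suc k ℕ.+ k)               ≡⟨ ≡.cong suc (ℕ.+-comm _ k) ⟩
    suc (block j) ℕ.* suc k                     ∎
    where open ℕ.≤-Reasoning

  block-suc : ∀ j → block (suc j) ≡ block j ⊎ block (suc j) ≡ suc (block j)
  block-suc j with index-suc j
  ... | inj₁ (eq , _) = inj₁ (≡.cong proj₁ eq)
  ... | inj₂ (eq , _) = inj₂ (≡.cong proj₁ eq)

module Lattice (em : ExcludedMiddle 0ℓ) (ℝ : CompleteOrderedField) (n : ℕ)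
  (r : CompleteOrderedField.Carrier ℝ)
  (2≤r : CompleteOrderedField._≤_ ℝ (CompleteOrderedField.2# ℝ) r) where
  open CompleteOrderedField ℝ hiding (zero)
  open OrderLemmas ℝ
  open FieldArithmetic em ℝ
  open LatticeWalks

  Lat : SimplicialComplex
  Lat = VR ℝ (ℤ^ ℝ n) r (2≤⇒0≤ ℝ 2≤r)

  open SimplicialComplex Lat
  open MetricSpace (ℤ^ ℝ n) using (isMetric)

  d : Vertex → Vertex → ℕ
  d = manhattan

  d-triangle : ∀ x y z → d x z ℕ.≤ d x y ℕ.+ d y z
  d-triangle x y z = fromℕ-cancel-≤ (≤-respʳ (sym (fromℕ-+ (d x y) (d y z))) (IsGeneralMetric.triangle isMetric x y z))

  d-sym : ∀ x y → d x y ℕ.≤ d y x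
  d-sym x y = fromℕ-cancel-≤ (≤-reflexive (IsGeneralMetric.sym isMetric x y))

  -- An integer bound, for counting steps and for local finiteness. It may exceed r, so simplices
  -- are always tested against r itself.
  radius : ∃[ R ] r ≤ fromℕ R
  radius = let R , r≤R = archimedean 0<1 r in R , ≤-respʳ (*-identityʳ _) r≤R

  R : ℕ
  R = proj₁ radius

  ≤r⇒≤R : ∀ {m} → fromℕ m ≤ r → m ℕ.≤ R
  ≤r⇒≤R p = fromℕ-cancel-≤ (≤.trans p (proj₂ radius))

  -- The hypothesis 2 ≤ r enters the geometry here, mainly through the diagonals of `unit-square`.
  ≤2⇒≤r : ∀ {m} → m ℕ.≤ 2 → fromℕ m ≤ r
  ≤2⇒≤r m≤2 = ≤.trans (fromℕ-mono m≤2) (≤.trans (≤-reflexive (+-congˡ (+-identityʳ 1#))) 2≤r)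

  locallyFinite : LocallyFinite Lat
  locallyFinite w = ball R w , λ (_ , diam) w∈σ v∈σ → ∈-ball R w _ (≤r⇒≤R (diam w _ w∈σ v∈σ))

  cons-simplex : ∀ {a σ} → IsSimplex σ → (∀ x → x ∈ σ → fromℕ (d a x) ≤ r) → IsSimplex (a ∷ σ)
  cons-simplex {a} {σ} (_ , diam) near = (λ ()) , λ where
    x y (here ≡.refl) (here ≡.refl) → ≤2⇒≤r (ℕ.≤-trans (ℕ.≤-reflexive (manhattan-self a)) ℕ.z≤n)
    x y (here ≡.refl) (there y∈)    → near y y∈
    x y (there x∈)    (here ≡.refl) → ≤.trans (fromℕ-mono (d-sym x a)) (near x x∈)
    x y (there x∈)    (there y∈)    → diam x y x∈ y∈

  quad-simplex : ∀ {a b c e} → fromℕ (d a b) ≤ r → fromℕ (d a c) ≤ r → fromℕ (d a e) ≤ r →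
                 fromℕ (d b c) ≤ r → fromℕ (d b e) ≤ r → fromℕ (d c e) ≤ r → IsSimplex (a ∷ b ∷ c ∷ e ∷ [])
  quad-simplex {e = e} ab ac ae bc be ce =
    cons-simplex (cons-simplex (cons-simplex (vertex e)
      (λ { _ (here ≡.refl) → ce }))
      (λ { _ (here ≡.refl) → bc ; _ (there (here ≡.refl)) → be }))
      (λ { _ (here ≡.refl) → ab ; _ (there (here ≡.refl)) → ac ; _ (there (there (here ≡.refl))) → ae })

  unit-square : ∀ {a b c e} → d a b ℕ.≤ 1 → d c e ℕ.≤ 1 → d a c ℕ.≤ 1 → d b e ℕ.≤ 1 →
                IsSimplex (a ∷ b ∷ c ∷ e ∷ [])
  unit-square {a} {b} {c} {e} ab ce ac be = quad-simplex (one ab) (one ac)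
      (≤2⇒≤r (ℕ.≤-trans (d-triangle a b e) (ℕ.+-mono-≤ ab be)))
      (≤2⇒≤r (ℕ.≤-trans (d-triangle b a c) (ℕ.+-mono-≤ (ℕ.≤-trans (d-sym b a) ab) ac)))
      (one be) (one ce)
    where
    one : ∀ {m} → m ℕ.≤ 1 → fromℕ m ≤ r
    one m≤1 = ≤2⇒≤r (ℕ.m≤n⇒m≤1+n m≤1)

  open RealizationPoint
  open LocallyFiniteRealization em ℝ Lat locallyFinite
  open Arcs em ℝ Lat locallyFinite
  open Subdivision em ℝ Lat locallyFinite

  unit-contiguous : ∀ {x y N 2≤N f} → (∀ j → j ℕ.< N → d (f j) (f (suc j)) ℕ.≤ 1) → Contiguous x y N 2≤N f f
  unit-contiguous {f = f} steps j 1+j<N = unit-square (steps j (ℕ.<⇒≤ 1+j<N)) (steps j (ℕ.<⇒≤ 1+j<N)) (self (f j)) (self (f (suc j)))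
    where
    self : ∀ v → d v v ℕ.≤ 1
    self v = ℕ.≤-trans (ℕ.≤-reflexive (manhattan-self v)) ℕ.z≤n

  path-between : ∀ x y → Path ℝ ∣K∣ x y
  path-between x y with support-nonempty x | support-nonempty y
  ... | a , xa≉0 | b , yb≉0 = toPath (thread x y (2 ℕ.+ T) 2≤ f (ends , unit-contiguous {x} {y} {2 ℕ.+ T} {2≤} {f} steps))
    where
    T : ℕ
    T = n ℕ.* d a b
    2≤ : 2 ℕ.≤ 2 ℕ.+ T
    2≤ = ℕ.s≤s (ℕ.s≤s ℕ.z≤n)
    f : ℕ → Vertex
    -- Shifted by one because node 0 is x: the walk is at a for index 1 and at b for index T + 1,
    -- the last one before y.
    f j = walk b (d a b) (j ∸ 1) a
    steps : ∀ j → j ℕ.< 2 ℕ.+ T → d (f j) (f (suc j)) ℕ.≤ 1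
    steps zero    _ = ℕ.≤-trans (ℕ.≤-reflexive (manhattan-self (f 0))) ℕ.z≤n
    steps (suc j) _ = walk-step b (d a b) j a ℕ.≤-refl
    ends : Ends x y (2 ℕ.+ T) 2≤ f
    ends = ≡.subst (_∈ carrier x) (≡.sym (walk-start b (d a b) a)) (support⊆carrier x xa≉0) ,
           ≡.subst (_∈ carrier y) (≡.sym (walk-end b (d a b) T a ℕ.≤-refl ℕ.≤-refl)) (support⊆carrier y yb≉0)

  -- Contracting a loop

  module Loop (x : Pt) (γ : Path ℝ ∣K∣ x x) (w : Vertex) (xw≉0 : ¬ (coord x w ≈ 0#))
    (G : Grid (fromPath γ) w xw≉0) where

    private
      w∈x : w ∈ carrier x
      w∈x = support⊆carrier x xw≉0

      path : UnitIntervalPoint ℝ → Pt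
      path t = Path.map γ ⟨$⟩ t

      open Grid G

      -- Walking an edge takes at most n R steps. Being a successor, k lets `index 1` compute to
      -- block 0 and offset 1, so that f₁ 1 lies on the constant first edge.
      k : ℕ
      k = suc (n ℕ.* R)

      open Blocks k

      M : ℕ
      M = size ℕ.* suc k

      size≤M : size ℕ.≤ M
      size≤M = ℕ.m≤m*n size (suc k)

      2≤M : 2 ℕ.≤ M
      2≤M = ℕ.≤-trans 2≤size size≤M

      label-dist : ∀ i → fromℕ (d (label i) (label (suc i))) ≤ r
      label-dist i = proj₂ (adjacent i) _ _ (here ≡.refl) (there (here ≡.refl))

      label-≤R : ∀ i → d (label i) (label (suc i)) ℕ.≤ R
      label-≤R i = ≤r⇒≤R (label-dist i)

      edge : ℕ → ℕ → Vertex
      edge i l = walk (label (suc i)) R l (label i)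

      -- Two edge paths with the same indexing: f₀ waits at a label while f₁ walks along the edge to
      -- the next.
      f₀ f₁ : ℕ → Vertex
      f₀ j = label (block j)
      f₁ j = edge (block j) (offset j)

      -- At the end of a block the walk has arrived, since n R < k, and the next edge starts at the
      -- same label.
      f₁-suc : ∀ j → f₁ (suc j) ≡ edge (block j) (suc (offset j))
      f₁-suc j with index-suc j
      ... | inj₁ (eq , _)   = ≡.cong (λ (i , l) → edge i l) eq
      ... | inj₂ (eq , k≤l) = ≡.trans (≡.cong (λ (i , l) → edge i l) eq) (≡.trans
            (walk-start (label (suc (suc (block j)))) R (label (suc (block j))))
            (≡.sym (walk-end (label (suc (block j))) R (suc (offset j)) (label (block j)) (label-≤R (block j))
              (ℕ.≤-trans (ℕ.n≤1+n _) (ℕ.m≤n⇒m≤1+n k≤l)))))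

      f₁-step : ∀ j → d (f₁ j) (f₁ (suc j)) ℕ.≤ 1
      f₁-step j = ≡.subst (λ v → d (f₁ j) v ℕ.≤ 1) (≡.sym (f₁-suc j))
        (walk-step (label (suc (block j))) R (offset j) (label (block j)) (label-≤R (block j)))

      -- Walked points stay as close to either end as the ends are to each other: to the start by
      -- `walk-between`, to the target because the walk is 1-Lipschitz and fixes it.
      edge-simplex : ∀ i l → IsSimplex (label i ∷ label (suc i) ∷ edge i l ∷ edge i (suc l) ∷ [])
      edge-simplex i l = quad-simplex (label-dist i) (from-start l) (from-start (suc l)) (from-end l) (from-end (suc l))
          (≤2⇒≤r (ℕ.m≤n⇒m≤1+n (walk-step b R l a (label-≤R i))))
        where
        a b : Vertex
        a = label i
        b = label (suc i)
        from-start : ∀ l → fromℕ (d a (edge i l)) ≤ r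
        from-start l = ≤.trans (fromℕ-mono (walk-between b R l a)) (label-dist i)
        from-end : ∀ l → fromℕ (d b (edge i l)) ≤ r
        from-end l = ≤.trans (fromℕ-mono (ℕ.≤-trans (d-sym b (edge i l))
          (≡.subst (λ c → d (edge i l) c ℕ.≤ d a b) (walk-fix b R l) (walk-lipschitz b R l a b)))) (label-dist i)

      f₀f₁-contiguous : Contiguous x x M 2≤M f₀ f₁
      f₀f₁-contiguous j _ = face (edge-simplex i (offset j)) sub (λ ())
        where
        i : ℕ
        i = block j
        second : f₀ (suc j) ∈ label i ∷ label (suc i) ∷ edge i (offset j) ∷ edge i (suc (offset j)) ∷ []
        second with block-suc j
        ... | inj₁ eq = here (≡.cong label eq)
        ... | inj₂ eq = there (here (≡.cong label eq))
        sub : square x x M 2≤M f₀ f₁ j ⊆ (label i ∷ label (suc i) ∷ edge i (offset j) ∷ edge i (suc (offset j)) ∷ [])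
        sub (here ≡.refl)                         = here ≡.refl
        sub (there (here ≡.refl))                 = second
        sub (there (there (here ≡.refl)))         = there (there (here ≡.refl))
        sub (there (there (there (here ≡.refl)))) = there (there (there (here (f₁-suc j))))

      f₀-contiguous : Contiguous x x M 2≤M f₀ f₀
      f₀-contiguous j p = face (f₀f₁-contiguous j p) sub (λ ())
        where
        sub : square x x M 2≤M f₀ f₀ j ⊆ square x x M 2≤M f₀ f₁ j
        sub (here e)                         = here e
        sub (there (here e))                 = there (here e)
        sub (there (there (here e)))         = here e
        sub (there (there (there (here e)))) = there (here e)

      last-block : ∀ j → M ℕ.≤ suc j → size ℕ.≤ suc (block j)
      last-block j M≤1+j = ℕ.*-cancelʳ-≤ size (suc (block j)) (suc k) (ℕ.≤-trans M≤1+j (<block* j))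

      M≤1+pred : M ℕ.≤ suc (ℕ.pred M)
      M≤1+pred = ℕ.≤-reflexive (≡.sym (ℕ.suc-pred M {{ℕ.>-nonZero (ℕ.≤-trans (ℕ.s≤s ℕ.z≤n) 2≤M)}}))

      f₁-first : ∀ j → j ℕ.≤ 1 → f₁ j ≡ w
      f₁-first zero          _ = ≡.trans (walk-start (label 1) R (label 0)) (first 0 ℕ.z≤n)
      -- Labels 0 and 1 are both w, so this is a walk from w to w.
      f₁-first (suc zero)    _ = ≡.trans (≡.cong₂ (λ b a → walk b R 1 a) (first 1 ℕ.≤-refl) (first 0 ℕ.z≤n)) (walk-fix w R 1)
      f₁-first (suc (suc j)) (ℕ.s≤s ())

      f₁-last : f₁ (ℕ.pred M) ≡ w
      f₁-last = ≡.trans (≡.cong₂ (λ b a → walk b R (offset j) a) (last _ (ℕ.m≤n⇒m≤1+n p)) (last _ p)) (walk-fix w R (offset j))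
        where
        j : ℕ
        j = ℕ.pred M
        p : size ℕ.≤ suc (block j)
        p = last-block j M≤1+pred

      -- Unit steps starting at w. Consequently M is a sufficient budget per coordinate for
      -- contracting the path onto w.
      f₁-bound : ∀ j → d (f₁ j) w ℕ.≤ j
      f₁-bound zero    = ℕ.≤-reflexive (≡.trans (≡.cong (λ v → d v w) (f₁-first 0 ℕ.z≤n)) (manhattan-self w))
      f₁-bound (suc j) = ℕ.≤-trans (d-triangle (f₁ (suc j)) (f₁ j) w)
        (ℕ.+-mono-≤ (ℕ.≤-trans (d-sym (f₁ (suc j)) (f₁ j)) (f₁-step j)) (f₁-bound j))

      T : ℕ
      T = n ℕ.* M

      g : ℕ → ℕ → Vertex
      g a j = walk w M a (f₁ j)

      g-step : ∀ a j → d (g a j) (g a (suc j)) ℕ.≤ 1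
      g-step a j = ℕ.≤-trans (walk-lipschitz w M a (f₁ j) (f₁ (suc j))) (f₁-step j)

      g-next : ∀ a j → j ℕ.≤ M → d (g a j) (g (suc a) j) ℕ.≤ 1
      g-next a j j≤M = walk-step w M a (f₁ j) (ℕ.≤-trans (f₁-bound j) j≤M)

      g-thread : ∀ a → Thread x x M 2≤M (g a)
      g-thread a = (≡.subst (_∈ carrier x) (≡.sym (fixed (f₁-first 1 ℕ.≤-refl))) w∈x ,
                    ≡.subst (_∈ carrier x) (≡.sym (fixed f₁-last)) w∈x) ,
                   unit-contiguous {x} {x} {M} {2≤M} {g a} (λ j _ → g-step a j)
        where
        fixed : ∀ {v} → v ≡ w → walk w M a v ≡ w
        fixed ≡.refl = walk-fix w M a

      g-contiguous : ∀ a → Contiguous x x M 2≤M (g a) (g (suc a))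
      g-contiguous a j 1+j<M = unit-square (g-step a j) (g-step (suc a) j)
        (g-next a j (ℕ.≤-trans (ℕ.n≤1+n j) (ℕ.<⇒≤ 1+j<M))) (g-next a (suc j) (ℕ.<⇒≤ 1+j<M))

      f₀-thread : Thread x x M 2≤M f₀
      f₀-thread = (≡.subst (_∈ carrier x) (≡.sym (first 0 ℕ.z≤n)) w∈x ,
                   ≡.subst (_∈ carrier x) (≡.sym (last _ (last-block (ℕ.pred M) M≤1+pred))) w∈x) , f₀-contiguous

      f₀g₀-contiguous : Contiguous x x M 2≤M f₀ (g 0)
      f₀g₀-contiguous j p = ≡.subst₂ (λ a b → IsSimplex (f₀ j ∷ f₀ (suc j) ∷ a ∷ b ∷ []))
        (≡.sym (walk-start w M (f₁ j))) (≡.sym (walk-start w M (f₁ (suc j)))) (f₀f₁-contiguous j p)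

      -- Since M is `size` times `suc k`, segment j of the thread is run through within the tick
      -- interval that starts at `block j`. There the carrier of the loop contains both labels of
      -- the interval, and in the end segments also the support of x.
      γ∼f₀ : fromPath γ ∼ thread x x M 2≤M f₀ f₀-thread
      γ∼f₀ = ∼thread x x M 2≤M {f₀} f₀-thread (fromPath γ) λ t →
          carrier (path t) , isSimplex (path t) , supported (path t) , λ j j<M p q →
          left t j j<M p q , right t j j<M p q
        where
        s : UnitIntervalPoint ℝ → Carrier
        s t = fromℕ size * value t
        Mt≈ : ∀ t → fromℕ M * value t ≈ fromℕ (suc k) * s t
        Mt≈ t = trans (*-congʳ (trans (fromℕ-* size (suc k)) (*-comm _ _))) (*-assoc _ _ _)
        0<k : 0# < fromℕ (suc k)
        0<k = 0<fromℕ {suc k} (ℕ.s≤s ℕ.z≤n)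
        lower : ∀ t j → fromℕ j ≤ fromℕ M * value t → fromℕ (block j) ≤ s t
        lower t j j≤Mt = *-cancelˡ-≤ 0<k (≤.trans (≤-reflexive (trans (*-comm _ _) (sym (fromℕ-* (block j) (suc k)))))
          (≤.trans (fromℕ-mono (block*≤ j)) (≤.trans j≤Mt (≤-reflexive (Mt≈ t)))))
        upper : ∀ t j → fromℕ M * value t ≤ fromℕ (suc j) → s t ≤ fromℕ (suc (block j))
        upper t j Mt≤1+j = *-cancelˡ-≤ 0<k (≤.trans (≤-reflexive (sym (Mt≈ t)))
          (≤.trans Mt≤1+j (≤.trans (fromℕ-mono (<block* j)) (≤-reflexive (trans (fromℕ-* (suc (block j)) (suc k)) (*-comm _ _))))))
        x∈ : ∀ t → (∀ v → ¬ (coord x v ≈ 0#) → ¬ (coord (path t) v ≈ 0#)) → In (carrier (path t)) x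
        x∈ t grow v v∉ = ≈0-stable λ xv≉0 → v∉ (support⊆carrier (path t) (grow v xv≉0))
        block<size : ∀ j → j ℕ.< M → block j ℕ.< size
        block<size j j<M = ℕ.*-cancelʳ-< (suc k) (block j) size (ℕ.≤-<-trans (block*≤ j) j<M)
        ≤+1 : ∀ {a b} → a ≤ b → a ≤ b + 1#
        ≤+1 {a} {b} p = ≤.trans p (≤-respˡ (+-identityʳ b) (+-monoʳ-≤ b 0≤1))
        covered : ∀ t j → j ℕ.< M → fromℕ j ≤ fromℕ M * value t → fromℕ M * value t ≤ fromℕ (suc j) →
                  ∀ i → i ≡ block j ⊎ i ≡ suc (block j) → label i ∈ carrier (path t)
        covered t j j<M p q _ (inj₁ ≡.refl) = support⊆carrier (path t)
          (covers (block j) t (ℕ.<⇒≤ (block<size j j<M)) (≤+1 (lower t j p))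
            (≤.trans (upper t j q) (≤-reflexive (fromℕ-suc (block j)))))
        covered t j j<M p q _ (inj₂ ≡.refl) = support⊆carrier (path t)
          (covers (suc (block j)) t (block<size j j<M)
            (≤.trans (≤-reflexive (fromℕ-suc (block j))) (+-monoˡ-≤ 1# (lower t j p)))
            (≤+1 (upper t j q)))
        left : ∀ t j → j ℕ.< M → fromℕ j ≤ fromℕ M * value t → fromℕ M * value t ≤ fromℕ (suc j) →
               In (carrier (path t)) (node x x M 2≤M f₀ j)
        left t j j<M p q = in-node x x M 2≤M f₀ j start
            (λ M≤j → ⊥-elim (ℕ.<⇒≱ j<M M≤j))
            (λ _ _ → covered t j j<M p q (block j) (inj₁ ≡.refl))
          where
          start : j ≡ 0 → In (carrier (path t)) x
          start j≡0 = x∈ t (near-0 t (≤.trans (upper t j q) (≤-reflexive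
            (trans (reflexive (≡.cong (λ i → fromℕ (suc (block i))) j≡0)) (+-identityʳ 1#)))))
        right : ∀ t j → j ℕ.< M → fromℕ j ≤ fromℕ M * value t → fromℕ M * value t ≤ fromℕ (suc j) →
                In (carrier (path t)) (node x x M 2≤M f₀ (suc j))
        right t j j<M p q = in-node x x M 2≤M f₀ (suc j) (λ ())
            (λ M≤1+j → x∈ t (near-1 t (≤.trans (fromℕ-mono (last-block j M≤1+j))
              (≤.trans (≤-reflexive (fromℕ-suc (block j))) (+-monoˡ-≤ 1# (lower t j p))))))
            (λ _ _ → covered t j j<M p q (block (suc j)) (block-suc j))

      trivial : Arc x x
      trivial = fromPath (constantPath ℝ ∣K∣ x)

      -- After n M moves every vertex in use is w. The thread still runs from x to w and back, but
      -- inside the carrier of x, which also contains the constant loop.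
      gT∼trivial : thread x x M 2≤M (g T) (g-thread T) ∼ trivial
      gT∼trivial = ∼-sym (∼thread x x M 2≤M {g T} (g-thread T) trivial λ t →
        carrier x , isSimplex x , supported x , λ j j<M _ _ →
        at-node j , at-node (suc j))
        where
        at-node : ∀ j → In (carrier x) (node x x M 2≤M (g T) j)
        at-node j = in-node x x M 2≤M (g T) j (λ _ → supported x) (λ _ → supported x)
          (λ _ j<M → ≡.subst (_∈ carrier x)
            (≡.sym (walk-end w M T (f₁ j) (ℕ.≤-trans (f₁-bound j) (ℕ.<⇒≤ j<M)) ℕ.≤-refl)) w∈x)

      contraction : ∀ e a → e ℕ.+ a ≡ T → Star _∼_ (thread x x M 2≤M (g a) (g-thread a)) trivial
      contraction zero    a ≡.refl = gT∼trivial ◅ Star.ε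
      contraction (suc e) a eq     = contiguous⇒∼ x x M 2≤M {g a} {g (suc a)} (g-thread a) (g-thread (suc a)) (g-contiguous a) ◅
                                     contraction e (suc a) (≡.trans (ℕ.+-suc e a) eq)

    null-homotopy : PathHomotopy ℝ ∣K∣ γ (constantPath ℝ ∣K∣ x)
    null-homotopy = homotopy γ (constantPath ℝ ∣K∣ x) γ∼f₀
      (contiguous⇒∼ x x M 2≤M {f₀} {g 0} f₀-thread (g-thread 0) f₀g₀-contiguous ◅ contraction T 0 (ℕ.+-identityʳ T))

theorem4p14 : ExcludedMiddle 0ℓ → (ℝ : CompleteOrderedField) → let open CompleteOrderedField ℝ in
    (n : ℕ) → 1 ℕ.≤ n → (r : Carrier) (2≤r : 2# ≤ r) →
    SimplyConnected ℝ (Realization ℝ (VR ℝ (ℤ^ ℝ n) r (2≤⇒0≤ ℝ 2≤r)))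
theorem4p14 em ℝ n _ r 2≤r = record
  { inhabited     = vertexPoint (Vec.replicate n ℤ.0ℤ)
  ; pathConnected = path-between
  ; trivialLoops  = λ x γ → let w , xw≉0 = support-nonempty x in
      Loop.null-homotopy x γ w xw≉0 (grid (fromPath γ) w xw≉0)
  }
  where
  open Lattice em ℝ n r 2≤r
  open Arcs em ℝ Lat locallyFinite
  open LocallyFiniteRealization em ℝ Lat locallyFinite
  open Subdivision em ℝ Lat locallyFinite
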